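{- Every one-pass randomized streaming algorithm for the matching parenthesis problem $\mathrm{DYCK}(2)$ on words of length $n'$ with (two-sided) error $O\!\left(\frac{1}{n'\log n'}\right)$ uses $\Omega(\sqrt{n'\log n'})$ space.
   Context: $\mathrm{DYCK}(2)$ is the language of well-parenthesized words with two types of parentheses: over the alphabet $\{a,\bar a,b,\bar b\}$ it is the smallest language $L$ satisfying $L=\{\epsilon\}\cup aL\bar aL\cup bL\bar bL$ ($a,b$ are opening parentheses, and $\bar a,\bar b$ the respective closing ones). $\mathrm{DYCK}(2)$ also denotes the problem of deciding whether a given word is in the language. A one-pass randomized streaming algorithm with space $s(n')$ reads the input stream $x_1,\ldots,x_{n'}$ letter by letter, once, in this order, while maintaining a memory space of size $s(n')$, and may use random coins; the length $n'$ is given in advance. Two-sided error $\varepsilon$ means that on every word of length $n'$, whether or not it is in the language, the decision is wrong with probability at most $\varepsilon$ over the coins.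
   Formalization: The lower bound is stated for all sufficiently large even n' only: for odd n' no word of length n' is in DYCK(2), so always rejecting is error-free and uses no space, and the claim fails there. -}

module Defs where

open import Data.Bool using (Bool; true; false; not; if_then_else_)
open import Data.Fin using (Fin; zero; suc)
open import Data.Integer using (+_)
open import Data.List using (List; []; _∷_; _++_)
open import Data.Nat using (ℕ; zero; suc; _≤?_)
import Data.Nat as ℕ
import Data.Nat.Properties as ℕ
open import Data.Product using (∃-syntax; _×_; _,_; proj₁; proj₂)
open import Data.Rational using (ℚ; 0ℚ; 1ℚ; ½; _+_; _*_; _≤_; _<_; _/_)
open import Data.Vec using (Vec; []; _∷_; toList)
open import Function using (_∘_)
open import Relation.Nullary using (¬_; yes; no)
open import Relation.Unary using (Pred)
open import Level using (0ℓ)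

data Letter : Set where
  a ā b b̄ : Letter

data Dyck₂ : Pred (List Letter) 0ℓ where
  ε    : Dyck₂ []
  aLāL : ∀ {u v} → Dyck₂ u → Dyck₂ v → Dyck₂ (a ∷ u ++ ā ∷ v)
  bLb̄L : ∀ {u v} → Dyck₂ u → Dyck₂ v → Dyck₂ (b ∷ u ++ b̄ ∷ v)

-- Probability of an event over k independent fair coin flips, by conditioning
-- on the first flip.
Pr : ∀ {k} → (Vec Bool k → Bool) → ℚ
Pr {zero}  E = if E [] then 1ℚ else 0ℚ
Pr {suc k} E = ½ * (Pr (E ∘ (true ∷_)) + Pr (E ∘ (false ∷_)))

-- A one-pass randomized streaming algorithm on inputs of length n over the
-- alphabet Σ, with s bits of memory.  Only what is kept between consecutive
-- letters counts as space.  The current position and all the coin flips can be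
-- consulted at no cost; an algorithm that flips fresh coins at each letter,
-- and has to store those it wants to reuse, is the special case in which each
-- step looks only at its own block of coins.
record Streaming (Σ : Set) (n s : ℕ) : Set where
  Memory : Set
  Memory = Vec Bool s

  field
    coins  : ℕ
    init   : Vec Bool coins → Memory
    step   : Vec Bool coins → Fin n → Σ → Memory → Memory
    accept : Vec Bool coins → Memory → Bool

  read : ∀ {m} → (Fin m → Σ → Memory → Memory) → Memory → Vec Σ m → Memory
  read δ μ []       = μ
  read δ μ (x ∷ xs) = read (δ ∘ suc) (δ zero x μ) xs

  output : Vec Σ n → Vec Bool coins → Bool
  output w r = accept r (read (step r) (init r) w)

TwoSidedError : ∀ {Σ n s} → Pred (List Σ) 0ℓ → Streaming Σ n s → ℚ → Set
TwoSidedError {Σ} {n} L A e = (w : Vec Σ n) →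
    (L (toList w)   → Pr (not ∘ output w) ≤ e)
  × (¬ L (toList w) → Pr (output w) ≤ e)
  where open Streaming A

fromℕ : ℕ → ℚ
fromℕ n = + n / 1

-- The value at 0 is a convention.
1/ℕ_ : ℕ → ℚ
1/ℕ zero  = 0ℚ
1/ℕ suc n = + 1 / suc n

√-step : ℕ → ℕ → ℕ
√-step n r with suc r ℕ.* suc r ≤? n
... | yes _ = suc r
... | no  _ = r

⌊√_⌋ : ℕ → ℕ
⌊√ zero ⌋  = zero
⌊√ suc n ⌋ = √-step (suc n) ⌊√ n ⌋

⌊√⌋-spec : ∀ n → ⌊√ n ⌋ ℕ.* ⌊√ n ⌋ ℕ.≤ n × n ℕ.< suc ⌊√ n ⌋ ℕ.* suc ⌊√ n ⌋
⌊√⌋-spec zero = ℕ.z≤n , ℕ.s≤s ℕ.z≤n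
⌊√⌋-spec (suc n) with suc ⌊√ n ⌋ ℕ.* suc ⌊√ n ⌋ ≤? suc n
... | yes p = p , ℕ.≤-<-trans (proj₂ (⌊√⌋-spec n))
                    (ℕ.*-mono-< (ℕ.n<1+n (suc ⌊√ n ⌋)) (ℕ.n<1+n (suc ⌊√ n ⌋)))
... | no ¬p = ℕ.m≤n⇒m≤1+n (proj₁ (⌊√⌋-spec n)) , ℕ.≰⇒> ¬p

-- f = O(g), for nonnegative f and g.
_∈O_ : (ℕ → ℚ) → (ℕ → ℚ) → Set
f ∈O g = ∃[ C ] ∃[ N ] 0ℚ < C × (∀ n → N ℕ.≤ n → f n ≤ C * g n)

-- f(n) = Ω(g(n)) as n → ∞ within P, for nonnegative f and g.
_∈Ω_along_ : (ℕ → ℚ) → (ℕ → ℚ) → Pred ℕ 0ℓ → Set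
f ∈Ω g along P =
  ∃[ c ] ∃[ N ] 0ℚ < c × (∀ n → N ℕ.≤ n → P n → c * g n ≤ f n)

-- Consider words made of m mountains: Alice pushes a word x of n brackets, Bob pops some k of
-- them, pushes them back and pads; after the last mountain everything is popped.  Such a word is
-- well-parenthesized unless Bob altered a bracket.
--
-- Fix the coins.  Let y share with x exactly the letters before position p and lead Alice to the
-- same memory.  Bob's honest claims of length below p for x are honest for y as well, but his
-- honest claim ending at p for x is wrong for y.  Hence, unless the algorithm errs on y, the two
-- kinds of claims lead to different final memories.  If s is much smaller than n, Kraft's
-- inequality provides many such y for most x and p, so the final memory and the remaining
-- (heavy) positions determine the positions of Bob's claims in all mountains, except on inputs
-- charged to errors.  This forces 2 ^ s to be at least about n ^ (m / 2).  Charging the errors to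
-- the n m pairs of a mountain and a position loses a factor O(N) on words of length N, which an
-- error O(1 / (N log N)) can afford; take n ≈ √(N log N) and m ≈ √(N / log N).
module Submission where

open import Defs
open import Data.Bool using (Bool; true; false; not; if_then_else_; _∧_; _xor_)
import Data.Bool.Properties as Bool
open import Data.Empty using (⊥)
open import Data.Fin as Fin using (Fin; zero; suc; toℕ)
import Data.Fin.Properties as Fin
import Data.Integer as ℤ
import Data.Integer.Properties as ℤ
open import Data.List using (List; []; _∷_; _++_; length; map; allFin; cartesianProduct; cartesianProductWith)
import Data.List.Properties as List
open import Data.List.Membership.Propositional using (_∈_)
open import Data.List.Membership.Propositional.Properties using (∈-cartesianProductWith⁺; ∈-cartesianProduct⁺; ∈-allFin; ∈-map⁺)
open import Data.List.Relation.Unary.All using (All; []; _∷_)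
import Data.List.Relation.Unary.AllPairs as AllPairs
open import Data.List.Relation.Unary.Any using (here; there)
open import Data.List.Relation.Unary.Unique.Propositional using (Unique)
import Data.List.Relation.Unary.Unique.Propositional.Properties as Unique
open import Data.Maybe using (Maybe; just; nothing; maybe′)
import Data.Maybe.Properties as Maybe
open import Data.Nat
open import Data.Nat.Divisibility using (_∣_; divides)
open import Data.Nat.DivMod using (m≡m%n+[m/n]*n; m%n<n; m/n*n≤m; m*n/n≡m; /-monoˡ-≤)
open import Data.Nat.Induction using (<-rec)
open import Data.Nat.Logarithm using (⌊log₂_⌋; ⌊log₂⌋-mono-≤; ⌊log₂[2^n]⌋≡n; ⌊log₂⌊n/2⌋⌋≡⌊log₂n⌋∸1)
open import Data.Nat.Properties
open import Data.Nat.Tactic.RingSolver using (solve-∀)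
open import Data.Product using (_×_; _,_; proj₁; proj₂; ∃-syntax)
import Data.Product.Properties as Product
open import Data.Rational as ℚ using (ℚ; 0ℚ; 1ℚ; ½; toℚᵘ)
import Data.Rational.Properties as ℚ
open import Data.Rational.Solver using (module +-*-Solver)
import Data.Rational.Unnormalised as ℚᵘ
import Data.Rational.Unnormalised.Properties as ℚᵘ
open import Data.Vec as Vec using (Vec; []; _∷_; toList; fromList)
import Data.Vec.Properties as Vec
open import Function using (_∘_)
open import Relation.Binary.Definitions using (DecidableEquality; tri<; tri≈; tri>)
open import Relation.Binary.PropositionalEquality
open import Relation.Nullary using (¬_; Dec; yes; no; ⌊_⌋; contradiction)

-- Finite sums

-- The height `n` and the number `m` of mountains balance two constraints: Kraft's inequality needs
-- `s` below a fixed fraction of `n`, the final count needs `s` below about half of `m * log n`, and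
-- the word length allows `m * n` of order `N`. Equating the two produces the square root. Only
-- positions count, at `log n` bits per mountain: the last phase pops all of Alice's words, so a
-- verdict may depend on them. The obstacle is that a collision of two honest inputs is no error by
-- itself; an error occurs only at a sibling `y` of `x`. Hence positions are charged to errors of
-- siblings, and the ratio `K` that defines heavy positions bounds how many words share the erring
-- siblings. `K` enters the final inequality as a factor, so it has to be constant; Kraft's
-- inequality with shares 3/4 and 1/4 makes `4 ^ 32 - 1` enough for positions to be heavy with
-- frequency at most 1/8. Since the position used by a colliding leaf is not known in advance, every
-- position of every mountain has to be free of charges; the one error of rejecting the honest claim
-- is therefore counted at all the other positions.

𝟙 : Bool → ℕ
𝟙 true  = 1
𝟙 false = 0

𝟙≤1 : ∀ t → 𝟙 t ≤ 1
𝟙≤1 true  = ≤-refl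
𝟙≤1 false = z≤n

𝟙-zero : ∀ t → 𝟙 t ≡ 0 → t ≡ false
𝟙-zero false _ = refl

𝟙-∧ : ∀ t u → 𝟙 (t ∧ u) ≡ 𝟙 t * 𝟙 u
𝟙-∧ true  u = sym (+-identityʳ (𝟙 u))
𝟙-∧ false u = refl

module _ {A : Set} where

  ∑ : List A → (A → ℕ) → ℕ
  ∑ []       f = 0
  ∑ (x ∷ xs) f = f x + ∑ xs f

  infix 8 ∑
  syntax ∑ xs (λ x → e) = ∑[ x ∈ xs ] e

  ∑-mono : ∀ {f g} xs → (∀ x → f x ≤ g x) → ∑ xs f ≤ ∑ xs g
  ∑-mono []       f≤g = z≤n
  ∑-mono (x ∷ xs) f≤g = +-mono-≤ (f≤g x) (∑-mono xs f≤g)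

  ∑-cong : ∀ {f g} xs → (∀ x → f x ≡ g x) → ∑ xs f ≡ ∑ xs g
  ∑-cong []       f≡g = refl
  ∑-cong (x ∷ xs) f≡g = cong₂ _+_ (f≡g x) (∑-cong xs f≡g)

  ∑-const : ∀ xs k → ∑ xs (λ _ → k) ≡ length xs * k
  ∑-const []       k = refl
  ∑-const (x ∷ xs) k = cong (k +_) (∑-const xs k)

  ∑-≤const : ∀ {f} xs {k} → (∀ x → f x ≤ k) → ∑ xs f ≤ length xs * k
  ∑-≤const xs {k} f≤k = ≤-trans (∑-mono xs f≤k) (≤-reflexive (∑-const xs k))

  ∑-+ : ∀ xs f g → ∑[ x ∈ xs ] (f x + g x) ≡ ∑ xs f + ∑ xs g
  ∑-+ []       f g = refl
  ∑-+ (x ∷ xs) f g = trans (cong (f x + g x +_) (∑-+ xs f g)) (interchange (f x) (g x) (∑ xs f) (∑ xs g))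
    where
    interchange : ∀ p q r s → p + q + (r + s) ≡ p + r + (q + s)
    interchange = solve-∀

  ∑-* : ∀ c xs f → ∑[ x ∈ xs ] (c * f x) ≡ c * ∑ xs f
  ∑-* c []       f = sym (*-zeroʳ c)
  ∑-* c (x ∷ xs) f = trans (cong (c * f x +_) (∑-* c xs f)) (sym (*-distribˡ-+ c (f x) (∑ xs f)))

  ∑-++ : ∀ xs ys f → ∑ (xs ++ ys) f ≡ ∑ xs f + ∑ ys f
  ∑-++ []       ys f = refl
  ∑-++ (x ∷ xs) ys f = trans (cong (f x +_) (∑-++ xs ys f)) (sym (+-assoc (f x) _ _))

  ∑-zero : ∀ xs → ∑ xs (λ _ → 0) ≡ 0
  ∑-zero []       = refl
  ∑-zero (x ∷ xs) = ∑-zero xs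

  ∑≡0⇒≡0 : ∀ {f xs x} → ∑ xs f ≡ 0 → x ∈ xs → f x ≡ 0
  ∑≡0⇒≡0 {f} {y ∷ ys} eq (here refl) = m+n≡0⇒m≡0 (f y) eq
  ∑≡0⇒≡0 {f} {y ∷ ys} eq (there x∈)  = ∑≡0⇒≡0 (m+n≡0⇒n≡0 (f y) eq) x∈

  ∈⇒≤∑ : ∀ {xs x} f → x ∈ xs → f x ≤ ∑ xs f
  ∈⇒≤∑ {y ∷ ys} f (here refl) = m≤m+n (f y) _
  ∈⇒≤∑ {y ∷ ys} f (there x∈)  = ≤-trans (∈⇒≤∑ f x∈) (m≤n+m _ (f y))

  ∑-unique≤1 : ∀ {xs} → Unique xs → (P : A → Bool) →
    (∀ {x y} → P x ≡ true → P y ≡ true → x ≡ y) → ∑[ x ∈ xs ] 𝟙 (P x) ≤ 1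
  ∑-unique≤1 AllPairs.[] P P! = z≤n
  ∑-unique≤1 {x ∷ xs} (x∉ AllPairs.∷ xs!) P P! with P x in Px
  ... | false = ∑-unique≤1 xs! P P!
  ... | true  = s≤s (≤-reflexive (none xs x∉))
    where
    none : ∀ ys → All (x ≢_) ys → ∑[ y ∈ ys ] 𝟙 (P y) ≡ 0
    none []       []          = refl
    none (y ∷ ys) (x≢y ∷ x∉) with P y in Py
    ... | true  = contradiction (P! Px Py) x≢y
    ... | false = none ys x∉

∑-map : ∀ {A B : Set} (h : A → B) xs f → ∑ (map h xs) f ≡ ∑ xs (f ∘ h)
∑-map h []       f = refl
∑-map h (x ∷ xs) f = cong (f (h x) +_) (∑-map h xs f)

module _ {A B : Set} where

  ∑-swap : ∀ (xs : List A) (ys : List B) (f : A → B → ℕ) →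
    ∑[ x ∈ xs ] (∑[ y ∈ ys ] f x y) ≡ ∑[ y ∈ ys ] (∑[ x ∈ xs ] f x y)
  ∑-swap []       ys f = sym (∑-zero ys)
  ∑-swap (x ∷ xs) ys f = trans (cong (∑ ys (f x) +_) (∑-swap xs ys f))
                               (sym (∑-+ ys (f x) (λ y → ∑[ x ∈ xs ] f x y)))

  ∑-cartesianProductWith : ∀ {C : Set} (h : A → B → C) xs ys f →
    ∑ (cartesianProductWith h xs ys) f ≡ ∑[ x ∈ xs ] (∑[ y ∈ ys ] f (h x y))
  ∑-cartesianProductWith h []       ys f = refl
  ∑-cartesianProductWith h (x ∷ xs) ys f =
    trans (∑-++ (map (h x) ys) _ f)
          (cong₂ _+_ (∑-map (h x) ys f) (∑-cartesianProductWith h xs ys f))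

module _ {A B : Set} (_≟_ : DecidableEquality B) {ys : List B} where

  ∑-fibres : ∀ (xs : List A) (h : A → B) → (∀ x → h x ∈ ys) → (f : B → A → ℕ) →
    ∑[ x ∈ xs ] f (h x) x ≤ ∑[ y ∈ ys ] (∑[ x ∈ xs ] (𝟙 ⌊ h x ≟ y ⌋ * f y x))
  ∑-fibres xs h h∈ f = ≤-trans
    (∑-mono xs λ x → ≤-trans (self x) (∈⇒≤∑ (λ y → 𝟙 ⌊ h x ≟ y ⌋ * f y x) (h∈ x)))
    (≤-reflexive (∑-swap xs ys λ x y → 𝟙 ⌊ h x ≟ y ⌋ * f y x))
    where
    self : ∀ x → f (h x) x ≤ 𝟙 ⌊ h x ≟ h x ⌋ * f (h x) x
    self x with h x ≟ h x
    ... | yes _  = m≤m+n _ 0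
    ... | no neq = contradiction refl neq

  ∑-fibres⁻ : Unique ys → ∀ (xs : List A) (h : A → B) (f : A → ℕ) →
    ∑[ y ∈ ys ] (∑[ x ∈ xs ] (𝟙 ⌊ h x ≟ y ⌋ * f x)) ≤ ∑ xs f
  ∑-fibres⁻ ys! xs h f = ≤-trans (≤-reflexive (∑-swap ys xs λ y x → 𝟙 ⌊ h x ≟ y ⌋ * f x)) (∑-mono xs λ x → begin
    ∑[ y ∈ ys ] (𝟙 ⌊ h x ≟ y ⌋ * f x)  ≡⟨ ∑-cong ys (λ y → *-comm (𝟙 ⌊ h x ≟ y ⌋) (f x)) ⟩
    ∑[ y ∈ ys ] (f x * 𝟙 ⌊ h x ≟ y ⌋)  ≡⟨ ∑-* (f x) ys _ ⟩
    f x * ∑[ y ∈ ys ] 𝟙 ⌊ h x ≟ y ⌋    ≤⟨ *-monoʳ-≤ (f x) (∑-unique≤1 ys! _ (λ {y} {z} p q → trans (sym (hit p)) (hit q))) ⟩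
    f x * 1                            ≡⟨ *-identityʳ (f x) ⟩
    f x ∎)
    where
    open ≤-Reasoning
    hit : ∀ {x y} → ⌊ h x ≟ y ⌋ ≡ true → h x ≡ y
    hit {x} {y} eq with h x ≟ y
    ... | yes p = p

  -- Grouped by the value of `h`, each fibre holds at most one `x` satisfying `P`. This will bound
  -- the number of clean leaves by the total weight of their codes.
  ∑-injective : ∀ {xs : List A} → Unique xs → (h : A → B) → (∀ x → h x ∈ ys) →
    (P : A → Bool) → (∀ {x x′} → P x ≡ true → P x′ ≡ true → h x ≡ h x′ → x ≡ x′) →
    (w : B → ℕ) → ∑[ x ∈ xs ] (𝟙 (P x) * w (h x)) ≤ ∑ ys w
  ∑-injective {xs} xs! h h∈ P inj w = ≤-trans
    (∑-fibres xs h h∈ (λ y x → 𝟙 (P x) * w y))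
    (∑-mono ys λ y → begin
      ∑[ x ∈ xs ] (𝟙 ⌊ h x ≟ y ⌋ * (𝟙 (P x) * w y))  ≡⟨ ∑-cong xs (λ x → regroup (𝟙 ⌊ h x ≟ y ⌋) (𝟙 (P x)) (w y)) ⟩
      ∑[ x ∈ xs ] (w y * (𝟙 ⌊ h x ≟ y ⌋ * 𝟙 (P x)))  ≡⟨ ∑-* (w y) xs _ ⟩
      w y * ∑[ x ∈ xs ] (𝟙 ⌊ h x ≟ y ⌋ * 𝟙 (P x))    ≡⟨ cong (w y *_) (∑-cong xs λ x → sym (𝟙-∧ ⌊ h x ≟ y ⌋ (P x))) ⟩
      w y * ∑[ x ∈ xs ] 𝟙 (⌊ h x ≟ y ⌋ ∧ P x)        ≤⟨ *-monoʳ-≤ (w y) (∑-unique≤1 xs! _ same) ⟩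
      w y * 1                                        ≡⟨ *-identityʳ (w y) ⟩
      w y ∎)
    where
    open ≤-Reasoning
    regroup : ∀ p q r → p * (q * r) ≡ r * (p * q)
    regroup = solve-∀
    same : ∀ {y x x′} → ⌊ h x ≟ y ⌋ ∧ P x ≡ true → ⌊ h x′ ≟ y ⌋ ∧ P x′ ≡ true → x ≡ x′
    same {y} {x} {x′} p q with h x ≟ y | h x′ ≟ y
    ... | yes e | yes e′ = inj p q (trans e (sym e′))

length-cartesianProductWith : ∀ {A B C : Set} (h : A → B → C) xs ys →
  length (cartesianProductWith h xs ys) ≡ length xs * length ys
length-cartesianProductWith h []       ys = refl
length-cartesianProductWith h (x ∷ xs) ys =
  trans (List.length-++ (map (h x) ys))
        (cong₂ _+_ (List.length-map (h x) ys) (length-cartesianProductWith h xs ys))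

vecs : {A : Set} → List A → ∀ n → List (Vec A n)
vecs xs zero    = [] ∷ []
vecs xs (suc n) = cartesianProductWith _∷_ xs (vecs xs n)

module _ {A : Set} {xs : List A} where

  ∑-vecs : ∀ n f → ∑ (vecs xs (suc n)) f ≡ ∑[ x ∈ xs ] (∑[ v ∈ vecs xs n ] f (x ∷ v))
  ∑-vecs n f = ∑-cartesianProductWith _∷_ xs (vecs xs n) f

  length-vecs : ∀ n → length (vecs xs n) ≡ length xs ^ n
  length-vecs zero    = refl
  length-vecs (suc n) = trans (length-cartesianProductWith _∷_ xs (vecs xs n)) (cong (length xs *_) (length-vecs n))

  ∈-vecs : (∀ x → x ∈ xs) → ∀ {n} (v : Vec A n) → v ∈ vecs xs n
  ∈-vecs all∈ []      = here refl
  ∈-vecs all∈ (x ∷ v) = ∈-cartesianProductWith⁺ _∷_ (all∈ x) (∈-vecs all∈ v)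

  vecs! : Unique xs → ∀ n → Unique (vecs xs n)
  vecs! xs! zero    = [] AllPairs.∷ AllPairs.[]
  vecs! xs! (suc n) = Unique.cartesianProductWith⁺ _∷_ Vec.∷-injective xs! (vecs! xs! n)

bits : List Bool
bits = true ∷ false ∷ []

∈-bits : ∀ t → t ∈ bits
∈-bits true  = here refl
∈-bits false = there (here refl)

bits! : Unique bits
bits! = ((λ ()) ∷ []) AllPairs.∷ [] AllPairs.∷ AllPairs.[]

-- Branching of sets of words

∑-bits : ∀ t f → ∑ bits f ≡ f t + f (not t)
∑-bits true  f = cong (f true +_) (+-identityʳ (f false))
∑-bits false f = trans (cong (f true +_) (+-identityʳ (f false))) (+-comm (f true) (f false))

∑-allFin : ∀ {n} f → ∑ (allFin (suc n)) f ≡ f zero + ∑ (allFin n) (f ∘ suc)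
∑-allFin {n} f = cong (f zero +_)
  (trans (cong (λ l → ∑ l f) (sym (List.map-tabulate (λ i → i) suc))) (∑-map suc (allFin n) f))

∑<∑⇒< : ∀ {A : Set} (xs : List A) f g → ∑ xs f < ∑ xs g → ∃[ x ] f x < g x
∑<∑⇒< (x ∷ xs) f g lt with f x <? g x
... | yes p = x , p
... | no ¬p = ∑<∑⇒< xs f g (≰⇒> λ le → <⇒≱ lt (+-mono-≤ (≮⇒≥ ¬p) le))

⌊⌋-true : ∀ {P : Set} (P? : Dec P) → ⌊ P? ⌋ ≡ true → P
⌊⌋-true (yes p) _ = p

⌊⌋-false : ∀ {P : Set} (P? : Dec P) → ⌊ P? ⌋ ≡ false → ¬ P
⌊⌋-false (no ¬p) _ = ¬p

^-distribʳ-* : ∀ n p q → (p * q) ^ n ≡ p ^ n * q ^ n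
^-distribʳ-* zero    p q = refl
^-distribʳ-* (suc n) p q = trans (cong (p * q *_) (^-distribʳ-* n p q)) (interchange p q (p ^ n) (q ^ n))
  where
  interchange : ∀ p q r s → p * q * (r * s) ≡ p * r * (q * s)
  interchange = solve-∀

Word : ℕ → Set
Word = Vec Bool

words : ∀ n → List (Word n)
words = vecs bits

-- What Bob pops, as far as position `p` inclusive, hence never empty. With `f = true` he lies,
-- about the last letter only.
claim : ∀ {n} → Word n → Fin n → Bool → List Bool
claim (t ∷ x) zero    f = (f xor t) ∷ []
claim (t ∷ x) (suc p) f = t ∷ claim x p f

size : ∀ {n} → (Word n → Bool) → ℕ
size {n} T = ∑ (words n) (𝟙 ∘ T)

infixr 7 _∩_
_∩_ : ∀ {n} → (Word n → Bool) → (Word n → Bool) → Word n → Bool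
(S ∩ T) x = S x ∧ T x

infixl 8 _∂_
-- Derivative of a language: descending one edge of the binary tree of words gives a set of words
-- again.
_∂_ : ∀ {n} → (Word (suc n) → Bool) → Bool → Word n → Bool
(T ∂ t) x = T (t ∷ x)

∑-words : ∀ n t f → ∑ (words (suc n)) f ≡ ∑ (words n) (f ∘ (t ∷_)) + ∑ (words n) (f ∘ (not t ∷_))
∑-words n t f = trans (∑-vecs n f) (∑-bits t λ u → ∑ (words n) (f ∘ (u ∷_)))

size-split : ∀ {n} (T : Word (suc n) → Bool) t → size T ≡ size (T ∂ t) + size (T ∂ not t)
size-split {n} T t = ∑-words n t (𝟙 ∘ T)

length-words : ∀ n → length (words n) ≡ 2 ^ n
length-words n = length-vecs n

size≤ : ∀ {n} (T : Word n → Bool) → size T ≤ 2 ^ n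
size≤ {n} T = begin
  size T                ≤⟨ ∑-≤const (words n) (𝟙≤1 ∘ T) ⟩
  length (words n) * 1  ≡⟨ *-identityʳ _ ⟩
  length (words n)      ≡⟨ length-words n ⟩
  2 ^ n                 ∎
  where open ≤-Reasoning

-- In terms of letters: y agrees with x before p and differs from x at p.
Sibling : ∀ {n} → Word n → Fin n → Word n → Set
Sibling x p y = claim y p true ≡ claim x p false × (∀ q → q Fin.< p → claim y q false ≡ claim x q false)

-- Union bound: two sets that each cover less than half of `S` miss some element of it.
avoid : ∀ {n} (S E F : Word n → Bool) → 2 * size (S ∩ E) < size S → 2 * size (S ∩ F) < size S →
  ∃[ y ] S y ≡ true × E y ≡ false × F y ≡ false
avoid {n} S E F e<s f<s with ∑<∑⇒< (words n) (λ y → 𝟙 ((S ∩ E) y) + 𝟙 ((S ∩ F) y)) (𝟙 ∘ S)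
                            (subst (_< size S) (sym (∑-+ (words n) _ _)) half)
  where
  half : size (S ∩ E) + size (S ∩ F) < size S
  half = *-cancelˡ-< 2 _ _ (begin-strict
    2 * (size (S ∩ E) + size (S ∩ F))      ≡⟨ *-distribˡ-+ 2 (size (S ∩ E)) _ ⟩
    2 * size (S ∩ E) + 2 * size (S ∩ F)    <⟨ +-mono-< e<s f<s ⟩
    size S + size S                        ≡⟨ cong (size S +_) (sym (+-identityʳ (size S))) ⟩
    2 * size S                             ∎)
    where open ≤-Reasoning
... | y , lt with S y in Sy | E y in Ey | F y in Fy
...   | true  | false | false = y , Sy , Ey , Fy
...   | true  | true  | _     = contradiction lt λ { (s≤s ()) }
...   | true  | false | true  = contradiction lt λ { (s≤s ()) }

module Branching (K : ℕ) where

  -- The siblings of `x` at `p` in `T` are outnumbered more than `K` to one. In particular a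
  -- position where a member of `T` has no sibling at all is heavy.
  heavy : ∀ {n} → (Word n → Bool) → Word n → Fin n → Bool
  heavy T (t ∷ x) zero    = ⌊ K * size (T ∂ not t) <? size (T ∂ t) ⌋
  heavy T (t ∷ x) (suc p) = heavy (T ∂ t) x p

  -- For a set E of errors: at least half of the siblings err.
  dirty : ∀ {n} → (Word n → Bool) → (Word n → Bool) → Word n → Fin n → Bool
  dirty T E (t ∷ x) zero    = not (heavy T (t ∷ x) zero) ∧ ⌊ size (T ∂ not t) ≤? 2 * size ((T ∩ E) ∂ not t) ⌋
  dirty T E (t ∷ x) (suc p) = dirty (T ∂ t) (E ∂ t) x p

  -- At a position that is neither heavy nor dirty, fewer than half of the siblings err. Two error
  -- sets are avoided at once because the two leaves of a collision may continue differently after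
  -- the current mountain.
  sibling : ∀ {n} (T E F : Word n → Bool) (x : Word n) p → heavy T x p ≡ false →
    dirty T E x p ≡ false → dirty T F x p ≡ false →
    ∃[ y ] T y ≡ true × E y ≡ false × F y ≡ false × Sibling x p y
  sibling T E F (t ∷ x) zero ¬h ¬d ¬d′
    rewrite ¬h
    with y , Ty , Ey , Fy ← avoid (T ∂ not t) (E ∂ not t) (F ∂ not t)
                              (≰⇒> (⌊⌋-false (_ ≤? _) ¬d)) (≰⇒> (⌊⌋-false (_ ≤? _) ¬d′))
    = not t ∷ y , Ty , Ey , Fy , cong (_∷ []) (Bool.not-involutive t) , λ _ ()
  sibling T E F (t ∷ x) (suc p) ¬h ¬d ¬d′
    with y , Ty , Ey , Fy , flip , agree ← sibling (T ∂ t) (E ∂ t) (F ∂ t) x p ¬h ¬d ¬d′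
    = t ∷ y , Ty , Ey , Fy , cong (t ∷_) flip , λ { zero _ → refl ; (suc q) (s≤s q<p) → cong (t ∷_) (agree q q<p) }

  -- After a fixed prefix, a branch that is not heavy is at most `K` times as large as its sibling
  -- branch, and if it is dirty at least half of the latter lies in `E`. So each member of `E` is
  -- charged at most `2 * K` times.
  ∑-dirty : ∀ {n} (T E : Word n → Bool) p →
    ∑[ x ∈ words n ] (𝟙 (T x) * 𝟙 (dirty T E x p)) ≤ 2 * K * size (T ∩ E)
  ∑-dirty {suc n} T E p@zero = begin
    ∑[ x ∈ words (suc n) ] (𝟙 (T x) * 𝟙 (dirty T E x zero))
      ≡⟨ ∑-words n true (λ x → 𝟙 (T x) * 𝟙 (dirty T E x zero)) ⟩
    part true + part false
      ≤⟨ +-mono-≤ (part≤ true) (part≤ false) ⟩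
    2 * K * size ((T ∩ E) ∂ false) + 2 * K * size ((T ∩ E) ∂ true)
      ≡⟨ *-distribˡ-+ (2 * K) (size ((T ∩ E) ∂ false)) _ ⟨
    2 * K * (size ((T ∩ E) ∂ false) + size ((T ∩ E) ∂ true))
      ≡⟨ cong (2 * K *_) (size-split (T ∩ E) false) ⟨
    2 * K * size (T ∩ E) ∎
    where
    open ≤-Reasoning
    part : Bool → ℕ
    part t = ∑[ x ∈ words n ] (𝟙 (T (t ∷ x)) * 𝟙 (dirty T E (t ∷ x) zero))
    swap : ∀ c s → c * (2 * s) ≡ 2 * c * s
    swap = solve-∀
    part≤ : ∀ t → part t ≤ 2 * K * size ((T ∩ E) ∂ not t)
    part≤ t with K * size (T ∂ not t) <? size (T ∂ t) | size (T ∂ not t) ≤? 2 * size ((T ∩ E) ∂ not t)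
    ... | yes _ | d     = ≤-trans (≤-reflexive (trans (∑-cong (words n) λ x → *-zeroʳ (𝟙 (T (t ∷ x)))) (∑-zero (words n)))) z≤n
    ... | no _  | no _  = ≤-trans (≤-reflexive (trans (∑-cong (words n) λ x → *-zeroʳ (𝟙 (T (t ∷ x)))) (∑-zero (words n)))) z≤n
    ... | no ≮  | yes ≤ = begin
      ∑[ x ∈ words n ] (𝟙 (T (t ∷ x)) * 1)  ≡⟨ ∑-cong (words n) (λ x → *-identityʳ (𝟙 (T (t ∷ x)))) ⟩
      size (T ∂ t)                          ≤⟨ ≮⇒≥ ≮ ⟩
      K * size (T ∂ not t)                  ≤⟨ *-monoʳ-≤ K ≤ ⟩
      K * (2 * size ((T ∩ E) ∂ not t))      ≡⟨ swap K (size ((T ∩ E) ∂ not t)) ⟩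
      2 * K * size ((T ∩ E) ∂ not t)        ∎
  ∑-dirty {suc n} T E (suc p) = begin
    ∑[ x ∈ words (suc n) ] (𝟙 (T x) * 𝟙 (dirty T E x (suc p)))
      ≡⟨ ∑-words n true (λ x → 𝟙 (T x) * 𝟙 (dirty T E x (suc p))) ⟩
    part true + part false
      ≤⟨ +-mono-≤ (∑-dirty (T ∂ true) (E ∂ true) p) (∑-dirty (T ∂ false) (E ∂ false) p) ⟩
    2 * K * size ((T ∩ E) ∂ true) + 2 * K * size ((T ∩ E) ∂ false)
      ≡⟨ *-distribˡ-+ (2 * K) (size ((T ∩ E) ∂ true)) _ ⟨
    2 * K * (size ((T ∩ E) ∂ true) + size ((T ∩ E) ∂ false))
      ≡⟨ cong (2 * K *_) (size-split (T ∩ E) true) ⟨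
    2 * K * size (T ∩ E) ∎
    where
    open ≤-Reasoning
    part : Bool → ℕ
    part t = ∑[ x ∈ words n ] (𝟙 (T (t ∷ x)) * 𝟙 (dirty T E (t ∷ x) (suc p)))

  -- Counting heavy positions by Kraft's inequality

  heavies : ∀ {n} → (Word n → Bool) → Word n → ℕ
  heavies {n} T x = ∑[ p ∈ allFin n ] 𝟙 (heavy T x p)

  -- A biased guess of the next letter, in quarters, for a branch of size `o` against a sibling
  -- branch of size `s`. Every heavy step gains a factor 3/2 over the fair share 2, and a step
  -- against a heavy branch loses a factor 2.
  share : ℕ → ℕ → ℕ
  share o s = if ⌊ K * s <? o ⌋ then 3 else if ⌊ K * o <? s ⌋ then 1 else 2

  share-sum : 1 ≤ K → ∀ o s → share o s + share s o ≤ 4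
  share-sum 1≤K o s with K * s <? o | K * o <? s
  ... | yes s<o | yes o<s = contradiction (≤-<-trans (m≤n*m s K {{>-nonZero 1≤K}}) s<o)
                                          (<⇒≯ (≤-<-trans (m≤n*m o K {{>-nonZero 1≤K}}) o<s))
  ... | yes _   | no _    = ≤-refl
  ... | no _    | yes _   = ≤-refl
  ... | no _    | no _    = ≤-refl

  weight : ∀ {n} → (Word n → Bool) → Word n → ℕ
  weight T []      = 1
  weight T (t ∷ x) = share (size (T ∂ t)) (size (T ∂ not t)) * weight (T ∂ t) x

  -- Kraft's inequality, for branching probabilities share / 4.
  kraft : 1 ≤ K → ∀ {n} (T : Word n → Bool) → ∑[ x ∈ words n ] (𝟙 (T x) * weight T x) ≤ 4 ^ n
  kraft 1≤K {zero} T = ≤-trans (≤-reflexive (trans (+-identityʳ _) (*-identityʳ (𝟙 (T []))))) (𝟙≤1 (T []))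
  kraft 1≤K {suc n} T = begin
    ∑[ x ∈ words (suc n) ] (𝟙 (T x) * weight T x)   ≡⟨ ∑-words n true (λ x → 𝟙 (T x) * weight T x) ⟩
    part true + part false                          ≤⟨ +-mono-≤ (part≤ true) (part≤ false) ⟩
    sh true * 4 ^ n + sh false * 4 ^ n              ≡⟨ *-distribʳ-+ (4 ^ n) (sh true) (sh false) ⟨
    (sh true + sh false) * 4 ^ n                    ≤⟨ *-monoˡ-≤ (4 ^ n) (share-sum 1≤K (size (T ∂ true)) (size (T ∂ false))) ⟩
    4 * 4 ^ n                                       ∎
    where
    open ≤-Reasoning
    sh : Bool → ℕ
    sh t = share (size (T ∂ t)) (size (T ∂ not t))
    part : Bool → ℕ
    part t = ∑[ x ∈ words n ] (𝟙 (T (t ∷ x)) * weight T (t ∷ x))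
    swap : ∀ p q r → p * (q * r) ≡ q * (p * r)
    swap = solve-∀
    part≤ : ∀ t → part t ≤ sh t * 4 ^ n
    part≤ t = begin
      part t                                                        ≡⟨ ∑-cong (words n) (λ x → swap (𝟙 (T (t ∷ x))) (sh t) _) ⟩
      ∑[ x ∈ words n ] (sh t * (𝟙 (T (t ∷ x)) * weight (T ∂ t) x))  ≡⟨ ∑-* (sh t) (words n) _ ⟩
      sh t * ∑[ x ∈ words n ] (𝟙 (T (t ∷ x)) * weight (T ∂ t) x)    ≤⟨ *-monoʳ-≤ (sh t) (kraft 1≤K (T ∂ t)) ⟩
      sh t * 4 ^ n                                                  ∎

  -- A light step (share 1) divides size by more than 4 ^ j, so there are at most n / j of them.
  weight≥ : ∀ j → suc K ≡ 4 ^ j → ∀ {n} (T : Word n → Bool) x → T x ≡ true →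
    (4 ^ n * 2 ^ heavies T x) ^ j ≤ (weight T x * weight T x) ^ j * size T
  weight≥ j K+1≡ T [] Tx rewrite Tx = ≤-reflexive (sym (*-identityʳ (1 ^ j)))
  weight≥ j K+1≡ {suc n} T (t ∷ x) Tx = begin
    (4 ^ suc n * 2 ^ heavies T (t ∷ x)) ^ j
      ≡⟨ cong (λ h → (4 ^ suc n * 2 ^ h) ^ j) (∑-allFin (𝟙 ∘ heavy T (t ∷ x))) ⟩
    (4 * 4 ^ n * 2 ^ (𝟙 h₀ + heavies (T ∂ t) x)) ^ j
      ≡⟨ cong (λ e → (4 * 4 ^ n * e) ^ j) (^-distribˡ-+-* 2 (𝟙 h₀) _) ⟩
    (4 * 4 ^ n * (2 ^ 𝟙 h₀ * 2 ^ heavies (T ∂ t) x)) ^ j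
      ≡⟨ cong (_^ j) (regroup (4 ^ n) (2 ^ 𝟙 h₀) (2 ^ heavies (T ∂ t) x)) ⟩
    (4 * 2 ^ 𝟙 h₀ * (4 ^ n * 2 ^ heavies (T ∂ t) x)) ^ j
      ≡⟨ ^-distribʳ-* j (4 * 2 ^ 𝟙 h₀) _ ⟩
    (4 * 2 ^ 𝟙 h₀) ^ j * (4 ^ n * 2 ^ heavies (T ∂ t) x) ^ j
      ≤⟨ *-monoʳ-≤ ((4 * 2 ^ 𝟙 h₀) ^ j) (weight≥ j K+1≡ (T ∂ t) x Tx) ⟩
    (4 * 2 ^ 𝟙 h₀) ^ j * ((w * w) ^ j * o)
      ≡⟨ swap ((4 * 2 ^ 𝟙 h₀) ^ j) ((w * w) ^ j) o ⟩
    (w * w) ^ j * ((4 * 2 ^ 𝟙 h₀) ^ j * o)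
      ≤⟨ *-monoʳ-≤ ((w * w) ^ j) (step o s) ⟩
    (w * w) ^ j * ((sh * sh) ^ j * (o + s))
      ≡⟨ *-assoc ((w * w) ^ j) ((sh * sh) ^ j) (o + s) ⟨
    (w * w) ^ j * (sh * sh) ^ j * (o + s)
      ≡⟨ cong₂ _*_ (trans (sym (^-distribʳ-* j (w * w) (sh * sh))) (cong (_^ j) (interchange w sh)))
                   (sym (size-split T t)) ⟩
    (weight T (t ∷ x) * weight T (t ∷ x)) ^ j * size T ∎
    where
    open ≤-Reasoning
    o s sh w : ℕ
    o  = size (T ∂ t)
    s  = size (T ∂ not t)
    sh = share o s
    w  = weight (T ∂ t) x
    h₀ = heavy T (t ∷ x) zero
    regroup : ∀ p q r → 4 * p * (q * r) ≡ 4 * q * (p * r)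
    regroup = solve-∀
    swap : ∀ p q r → p * (q * r) ≡ q * (p * r)
    swap = solve-∀
    interchange : ∀ p q → p * p * (q * q) ≡ q * p * (q * p)
    interchange = solve-∀
    step : ∀ o s → (4 * 2 ^ 𝟙 ⌊ K * s <? o ⌋) ^ j * o ≤ (share o s * share o s) ^ j * (o + s)
    step o s with K * s <? o | K * o <? s
    -- The gain 3/2 is at least √2: `4 * 2 = 8` is below `3 * 3 = 9`. This is why the invariant
    -- speaks of the squared weight.
    ... | yes _ | _       = *-mono-≤ (^-monoˡ-≤ j (n≤1+n 8)) (m≤m+n o s)
    ... | no _  | no _    = *-monoʳ-≤ (4 ^ j) (m≤m+n o s)
    ... | no _  | yes o<s = begin
      4 ^ j * o          ≡⟨ cong (_* o) K+1≡ ⟨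
      o + K * o          ≤⟨ +-monoʳ-≤ o (<⇒≤ o<s) ⟩
      o + s              ≡⟨ +-identityʳ (o + s) ⟨
      1 * (o + s)        ≡⟨ cong (_* (o + s)) (^-zeroˡ j) ⟨
      1 ^ j * (o + s)    ∎

  -- For `n ≡ 2 * q * j` the bound `2 ^ n` on the size is the `j`-th power of `2 ^ (2 * q)`. After
  -- taking `j`-th roots, light steps eat up only half of the gain `2 ^ (4 * q)` in the squared
  -- weight, and a square root leaves `2 ^ q`.
  many-heavies : ∀ j .{{_ : NonZero j}} → suc K ≡ 4 ^ j → ∀ {n} q → n ≡ 2 * q * j →
    ∀ (T : Word n → Bool) x → T x ≡ true → 4 * q ≤ heavies T x → 2 ^ (n + q) ≤ weight T x
  many-heavies j K+1≡ {n} q n≡ T x Tx many = ≮⇒≥ λ w< → <-irrefl refl (begin-strict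
    (W * W * 2 ^ (2 * q)) ^ j            ≡⟨ cong (_^ j) exponents ⟩
    (4 ^ n * 2 ^ (4 * q)) ^ j            ≤⟨ ^-monoˡ-≤ j (*-monoʳ-≤ (4 ^ n) (^-monoʳ-≤ 2 many)) ⟩
    (4 ^ n * 2 ^ heavies T x) ^ j        ≤⟨ weight≥ j K+1≡ T x Tx ⟩
    (w * w) ^ j * size T                 ≤⟨ *-monoʳ-≤ ((w * w) ^ j) (size≤ T) ⟩
    (w * w) ^ j * 2 ^ n                  ≡⟨ cong (λ e → (w * w) ^ j * 2 ^ e) n≡ ⟩
    (w * w) ^ j * 2 ^ (2 * q * j)        ≡⟨ cong ((w * w) ^ j *_) (^-*-assoc 2 (2 * q) j) ⟨
    (w * w) ^ j * (2 ^ (2 * q)) ^ j      ≡⟨ ^-distribʳ-* j (w * w) (2 ^ (2 * q)) ⟨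
    (w * w * 2 ^ (2 * q)) ^ j            <⟨ ^-monoˡ-< j (*-monoˡ-< (2 ^ (2 * q)) {{m^n≢0 2 (2 * q)}} (*-mono-< w< w<)) ⟩
    (W * W * 2 ^ (2 * q)) ^ j            ∎)
    where
    open ≤-Reasoning
    w W : ℕ
    w = weight T x
    W = 2 ^ (n + q)
    sum : ∀ n q → n + q + (n + q) + 2 * q ≡ 2 * n + 4 * q
    sum = solve-∀
    exponents : W * W * 2 ^ (2 * q) ≡ 4 ^ n * 2 ^ (4 * q)
    exponents = begin-equality
      W * W * 2 ^ (2 * q)                  ≡⟨ cong (_* 2 ^ (2 * q)) (^-distribˡ-+-* 2 (n + q) (n + q)) ⟨
      2 ^ (n + q + (n + q)) * 2 ^ (2 * q)  ≡⟨ ^-distribˡ-+-* 2 (n + q + (n + q)) (2 * q) ⟨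
      2 ^ (n + q + (n + q) + 2 * q)        ≡⟨ cong (2 ^_) (sum n q) ⟩
      2 ^ (2 * n + 4 * q)                  ≡⟨ ^-distribˡ-+-* 2 (2 * n) (4 * q) ⟩
      2 ^ (2 * n) * 2 ^ (4 * q)            ≡⟨ cong (_* 2 ^ (4 * q)) (^-*-assoc 2 2 n) ⟨
      4 ^ n * 2 ^ (4 * q)                  ∎

  -- Words with many heavy positions weigh at least `2 ^ (n + q)` each, and Kraft's inequality
  -- bounds the total weight by `4 ^ n`.
  few-many-heavies : 1 ≤ K → ∀ j .{{_ : NonZero j}} → suc K ≡ 4 ^ j → ∀ {n} q → n ≡ 2 * q * j → ∀ (T : Word n → Bool) →
    2 ^ q * ∑[ x ∈ words n ] (𝟙 (T x) * 𝟙 ⌊ 4 * q ≤? heavies T x ⌋) ≤ 2 ^ n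
  few-many-heavies 1≤K j K+1≡ {n} q n≡ T = *-cancelˡ-≤ (2 ^ n) {{m^n≢0 2 n}} (begin
    2 ^ n * (2 ^ q * ∑ (words n) F)           ≡⟨ *-assoc (2 ^ n) (2 ^ q) _ ⟨
    2 ^ n * 2 ^ q * ∑ (words n) F             ≡⟨ cong (_* ∑ (words n) F) (^-distribˡ-+-* 2 n q) ⟨
    2 ^ (n + q) * ∑ (words n) F               ≡⟨ ∑-* (2 ^ (n + q)) (words n) F ⟨
    ∑[ x ∈ words n ] (2 ^ (n + q) * F x)      ≤⟨ ∑-mono (words n) bound ⟩
    ∑[ x ∈ words n ] (𝟙 (T x) * weight T x)   ≤⟨ kraft 1≤K T ⟩
    4 ^ n                                     ≡⟨ ^-distribʳ-* n 2 2 ⟩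
    2 ^ n * 2 ^ n                             ∎)
    where
    open ≤-Reasoning
    F : Word n → ℕ
    F x = 𝟙 (T x) * 𝟙 ⌊ 4 * q ≤? heavies T x ⌋
    bound : ∀ x → 2 ^ (n + q) * F x ≤ 𝟙 (T x) * weight T x
    bound x with T x in Tx | 4 * q ≤? heavies T x
    ... | false | _        = ≤-reflexive (*-zeroʳ (2 ^ (n + q)))
    ... | true  | no _     = ≤-trans (≤-reflexive (*-zeroʳ (2 ^ (n + q)))) z≤n
    ... | true  | yes many = ≤-trans (≤-reflexive (*-identityʳ (2 ^ (n + q))))
                                     (≤-trans (many-heavies j K+1≡ q n≡ T x Tx many) (m≤m+n _ 0))

  module _ {s n} (g : Word n → Word s) where

    class : Word s → Word n → Bool
    class M x = ⌊ Vec.≡-dec Bool._≟_ (g x) M ⌋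

    -- Over all `2 ^ s` classes at most `2 ^ (n + s - q)` words, a fraction 1/16, have `4 * q` or
    -- more heavy positions. All others have fewer than `4 * q`, which is `n / 16` by the choice
    -- `j = 32`; the two parts add up to an average of at most `n / 8`.
    ∑-heavy : 1 ≤ K → suc K ≡ 4 ^ 32 → ∀ q → n ≡ 2 * q * 32 → s + 4 ≤ q →
      8 * ∑[ x ∈ words n ] heavies (class (g x)) x ≤ n * 2 ^ n
    ∑-heavy 1≤K K+1≡ q n≡ s+4≤q = *-cancelˡ-≤ 2 (begin
      2 * (8 * ∑[ x ∈ words n ] hv x)                               ≡⟨ *-assoc 2 8 (∑ (words n) hv) ⟨
      16 * ∑[ x ∈ words n ] hv x                                    ≤⟨ *-monoʳ-≤ 16 (∑-mono (words n) cut) ⟩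
      16 * ∑[ x ∈ words n ] (4 * q + n * many x)                    ≡⟨ cong (16 *_) (∑-+ (words n) (λ _ → 4 * q) _) ⟩
      16 * (∑[ x ∈ words n ] (4 * q) + ∑[ x ∈ words n ] (n * many x)) ≡⟨ cong₂ (λ u v → 16 * (u + v)) (trans (∑-const (words n) (4 * q)) (cong (_* (4 * q)) (length-words n))) (∑-* n (words n) many) ⟩
      16 * (2 ^ n * (4 * q) + n * ∑ (words n) many)                 ≡⟨ expand (2 ^ n) q n (∑ (words n) many) ⟩
      2 * q * 32 * 2 ^ n + n * (16 * ∑ (words n) many)              ≤⟨ +-mono-≤ (≤-reflexive (cong (_* 2 ^ n) (sym n≡))) (*-monoʳ-≤ n rare) ⟩
      n * 2 ^ n + n * 2 ^ n                                         ≡⟨ cong (n * 2 ^ n +_) (+-identityʳ (n * 2 ^ n)) ⟨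
      2 * (n * 2 ^ n)                                               ∎)
      where
      open ≤-Reasoning
      hv many : Word n → ℕ
      hv x   = heavies (class (g x)) x
      many x = 𝟙 ⌊ 4 * q ≤? hv x ⌋
      expand : ∀ N q n m → 16 * (N * (4 * q) + n * m) ≡ 2 * q * 32 * N + n * (16 * m)
      expand = solve-∀
      hv≤n : ∀ x → hv x ≤ n
      hv≤n x = ≤-trans (∑-≤const (allFin n) λ p → 𝟙≤1 (heavy (class (g x)) x p))
                       (≤-reflexive (trans (*-identityʳ _) (List.length-tabulate (λ i → i))))
      cut : ∀ x → hv x ≤ 4 * q + n * many x
      cut x with 4 * q ≤? hv x
      ... | yes _ = ≤-trans (hv≤n x) (≤-trans (≤-reflexive (sym (*-identityʳ n))) (m≤n+m _ (4 * q)))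
      ... | no ≰  = ≤-trans (<⇒≤ (≰⇒> ≰)) (m≤m+n _ _)
      many-in : Word s → ℕ
      many-in M = ∑[ x ∈ words n ] (𝟙 (class M x) * 𝟙 ⌊ 4 * q ≤? heavies (class M) x ⌋)
      rare : 16 * ∑ (words n) many ≤ 2 ^ n
      rare = *-cancelˡ-≤ (2 ^ s) {{m^n≢0 2 s}} (begin
        2 ^ s * (16 * ∑ (words n) many)         ≡⟨ *-assoc (2 ^ s) 16 _ ⟨
        2 ^ s * 2 ^ 4 * ∑ (words n) many        ≡⟨ cong (_* ∑ (words n) many) (^-distribˡ-+-* 2 s 4) ⟨
        2 ^ (s + 4) * ∑ (words n) many          ≤⟨ *-mono-≤ (^-monoʳ-≤ 2 s+4≤q) (∑-fibres (Vec.≡-dec Bool._≟_) (words n) g (λ x → ∈-vecs ∈-bits (g x)) λ M x → 𝟙 ⌊ 4 * q ≤? heavies (class M) x ⌋) ⟩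
        2 ^ q * ∑[ M ∈ words s ] many-in M      ≡⟨ ∑-* (2 ^ q) (words s) many-in ⟨
        ∑[ M ∈ words s ] (2 ^ q * many-in M)    ≤⟨ ∑-≤const (words s) (λ M → few-many-heavies 1≤K 32 K+1≡ q n≡ (class M)) ⟩
        length (words s) * 2 ^ n                ≡⟨ cong (_* 2 ^ n) (length-words s) ⟩
        2 ^ s * 2 ^ n                           ∎)

-- Protocols for the mountain problem

-- A leaf is an honest input, seen as a leaf of the tree that branches on Alice's words and Bob's
-- positions. The extra flag of an input tells whether Bob lies in that mountain.
Leaf Input : ℕ → ℕ → Set
Leaf  n = Vec (Word n × Fin n)
Input n = Vec (Word n × Fin n × Bool)

honest : ∀ {n m} → Leaf n m → Input n m
honest []            = []
honest ((x , k) ∷ t) = (x , k , false) ∷ honest t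

data Altered {n} : ∀ {m} → Input n m → Set where
  here  : ∀ {m x k} {t : Input n m} → Altered ((x , k , true) ∷ t)
  there : ∀ {m e} {t : Input n m} → Altered t → Altered (e ∷ t)

leaves : ∀ n m → List (Leaf n m)
leaves n = vecs (cartesianProduct (words n) (allFin n))

leaves! : ∀ n m → Unique (leaves n m)
leaves! n = vecs! (Unique.cartesianProduct⁺ (vecs! bits! n) (Unique.allFin⁺ n))

length-allFin : ∀ n → length (allFin n) ≡ n
length-allFin n = List.length-tabulate (λ i → i)

length-leaves : ∀ n m → length (leaves n m) ≡ (2 ^ n * n) ^ m
length-leaves n m = trans (length-vecs m) (cong (_^ m)
  (trans (length-cartesianProductWith _,_ (words n) (allFin n)) (cong₂ _*_ (length-words n) (length-allFin n))))

∑-leaves : ∀ n m f → ∑ (leaves n (suc m)) f ≡ ∑[ x ∈ words n ] (∑[ k ∈ allFin n ] (∑[ t ∈ leaves n m ] f ((x , k) ∷ t)))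
∑-leaves n m f = trans (∑-vecs {xs = cartesianProduct (words n) (allFin n)} m f)
  (∑-cartesianProductWith _,_ (words n) (allFin n) λ xk → ∑[ t ∈ leaves n m ] f (xk ∷ t))

module Protocol (K : ℕ) {s n : ℕ}
  (alice : ℕ → Word s → Word n → Word s) (bob : ℕ → Word s → List Bool → Word s) where

  open Branching K

  Code : ℕ → Set
  Code = Vec (Word n × Maybe (Fin n))

  -- Besides the last memory, a verdict sees all of Alice's words: it stands for the phase of the
  -- input that pops them.
  Verdict : ℕ → Set
  Verdict m = Word s → Vec (Word n) m → Bool

  infixl 6 _▹_
  _▹_ : ∀ {m} → Verdict (suc m) → Word n → Verdict m
  (F ▹ x) M xs = F M (x ∷ xs)

  next : ℕ → Word s → Word n → Fin n → Bool → Word s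
  next i μ x k f = bob i (alice i μ x) (claim x k f)

  final : ∀ {m} → ℕ → Word s → Input n m → Word s
  final i μ []                = μ
  final i μ ((x , k , f) ∷ t) = final (suc i) (next i μ x k f) t

  accepts : ∀ {m} → ℕ → Word s → Verdict m → Input n m → Bool
  accepts i μ F t = F (final i μ t) (Vec.map proj₁ t)

  -- The error paid for at position p when Alice's word is y: rejecting the honest claim k ≠ p,
  -- or accepting the altered claim p.
  err : ∀ {m} → ℕ → Word s → Verdict (suc m) → Leaf n m → Fin n → Fin n → Word n → Bool
  err i μ F t k p y =
    if ⌊ k Fin.≟ p ⌋ then accepts i μ F ((y , p , true) ∷ honest t)
                     else not (accepts i μ F ((y , k , false) ∷ honest t))

  like : ℕ → Word s → Word n → Word n → Bool
  like i μ x = class (alice i μ) (alice i μ x)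

  -- Both follow the honest run and look at all `n` positions of each mountain, because any of them
  -- may turn out to be the position of a colliding leaf.
  errs dirties : ∀ {m} → ℕ → Word s → Verdict m → Leaf n m → ℕ
  errs i μ F []            = 0
  errs i μ F ((x , k) ∷ t) = ∑[ p ∈ allFin n ] 𝟙 (err i μ F t k p x)
                           + errs (suc i) (next i μ x k false) (F ▹ x) t
  dirties i μ F []            = 0
  dirties i μ F ((x , k) ∷ t) = ∑[ p ∈ allFin n ] 𝟙 (dirty (like i μ x) (err i μ F t k p) x p)
                              + dirties (suc i) (next i μ x k false) (F ▹ x) t

  bads : ∀ {m} → ℕ → Word s → Leaf n m → ℕ
  bads i μ []            = 0
  bads i μ ((x , k) ∷ t) = 𝟙 (heavy (like i μ x) x k) + bads (suc i) (next i μ x k false) t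

  -- Recording the heavy k makes two leaves of equal code differ first at a level without tag.
  code : ∀ {m} → ℕ → Word s → Leaf n m → Code m
  code i μ []            = []
  code i μ ((x , k) ∷ t) = (x , (if heavy (like i μ x) x k then just k else nothing))
                         ∷ code (suc i) (next i μ x k false) t

  strings-code : ∀ {m} i μ (t : Leaf n m) → Vec.map proj₁ (code i μ t) ≡ Vec.map proj₁ (honest t)
  strings-code i μ []            = refl
  strings-code i μ ((x , k) ∷ t) = cong (x ∷_) (strings-code (suc i) _ t)

  like-alice : ∀ i μ x y → like i μ x y ≡ true → alice i μ y ≡ alice i μ x
  like-alice i μ x y = ⌊⌋-true (Vec.≡-dec Bool._≟_ (alice i μ y) (alice i μ x))

  -- Replacing x by its sibling y at p changes neither Bob's claims for k < p nor Alice's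
  -- message, so the correct input (y , k) and the incorrect input (y , p) end in the same memory.
  no-collision : ∀ {m} i μ (F : Verdict (suc m)) x {k p} (t t′ : Leaf n m) → k Fin.< p →
    heavy (like i μ x) x p ≡ false →
    dirty (like i μ x) (err i μ F t k p) x p ≡ false →
    dirty (like i μ x) (err i μ F t′ p p) x p ≡ false →
    Vec.map proj₁ (honest t) ≡ Vec.map proj₁ (honest t′) →
    final i μ (honest ((x , k) ∷ t)) ≡ final i μ (honest ((x , p) ∷ t′)) → ⊥
  no-collision i μ F x {k} {p} t t′ k<p light clean clean′ xs≡ final≡
    with y , y∼x , ok , ok′ , flip , agree ← sibling (like i μ x) (err i μ F t k p) (err i μ F t′ p p) x p light clean clean′
    with k Fin.≟ p | p Fin.≟ p
  ... | yes k≡p | _      = <⇒≢ k<p (cong Fin.toℕ k≡p)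
  ... | no _    | no p≢p = p≢p refl
  ... | no _    | yes _  = contradiction (trans (sym accepted) ok′) λ ()
    where
    open ≡-Reasoning
    F-correct : accepts i μ F ((y , k , false) ∷ honest t) ≡ true
    F-correct = Bool.not-injective ok
    next≡ : ∀ {w w′} → w ≡ w′ → bob i (alice i μ y) w ≡ bob i (alice i μ x) w′
    next≡ = cong₂ (bob i) (like-alice i μ x y y∼x)
    accepted : accepts i μ F ((y , p , true) ∷ honest t′) ≡ true
    accepted = begin
      F (final (suc i) (next i μ y p true) (honest t′)) (y ∷ Vec.map proj₁ (honest t′))
        ≡⟨ cong₂ (λ M xs → F (final (suc i) M (honest t′)) (y ∷ xs)) (next≡ flip) (sym xs≡) ⟩
      F (final (suc i) (next i μ x p false) (honest t′)) (y ∷ Vec.map proj₁ (honest t))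
        ≡⟨ cong (λ M → F M (y ∷ Vec.map proj₁ (honest t))) (sym final≡) ⟩
      F (final (suc i) (next i μ x k false) (honest t)) (y ∷ Vec.map proj₁ (honest t))
        ≡⟨ cong (λ M → F (final (suc i) M (honest t)) (y ∷ Vec.map proj₁ (honest t))) (sym (next≡ (agree k k<p))) ⟩
      accepts i μ F ((y , k , false) ∷ honest t)
        ≡⟨ F-correct ⟩
      true ∎

  untagged : ∀ (c c′ : Bool) {k k′ : Fin n} → k ≢ k′ →
    (if c then just k else nothing) ≡ (if c′ then just k′ else nothing) → c ≡ false × c′ ≡ false
  untagged false false _    _    = refl , refl
  untagged true  true  k≢k′ eq   = contradiction (Maybe.just-injective eq) k≢k′

  -- Equal codes contain the same words, so two leaves can first differ only in a position. Neither
  -- position is tagged there, so the larger one is not heavy; it is also clean for both leaves, and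
  -- `no-collision` applies.
  clean-injective : ∀ {m} i μ (F : Verdict m) (t t′ : Leaf n m) →
    dirties i μ F t ≡ 0 → dirties i μ F t′ ≡ 0 →
    code i μ t ≡ code i μ t′ → final i μ (honest t) ≡ final i μ (honest t′) → t ≡ t′
  clean-injective i μ F [] [] _ _ _ _ = refl
  clean-injective i μ F ((x , k) ∷ t) ((x′ , k′) ∷ t′) d d′ code≡ final≡
    with head≡ , tail≡ ← Vec.∷-injective code≡
    with refl , tag≡ ← Product.,-injective head≡
    with Fin.<-cmp k k′
  ... | tri≈ _ refl _ = cong ((x , k) ∷_) (clean-injective (suc i) _ (F ▹ x) t t′
                          (m+n≡0⇒n≡0 _ d) (m+n≡0⇒n≡0 _ d′) tail≡ final≡)
  ... | tri< k<k′ k≢k′ _ = contradiction final≡ (no-collision i μ F x t t′ k<k′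
          (proj₂ (untagged _ _ k≢k′ tag≡)) (clean d) (clean d′) xs≡)
    where
    clean : ∀ {l t} → dirties i μ F ((x , l) ∷ t) ≡ 0 → dirty (like i μ x) (err i μ F t l k′) x k′ ≡ false
    clean {l} {t} d = 𝟙-zero _ (∑≡0⇒≡0 {f = λ p → 𝟙 (dirty (like i μ x) (err i μ F t l p) x p)} (m+n≡0⇒m≡0 _ d) (∈-allFin k′))
    xs≡ = trans (sym (strings-code _ _ t)) (trans (cong (Vec.map proj₁) tail≡) (strings-code _ _ t′))
  ... | tri> _ k≢k′ k′<k = contradiction (sym final≡) (no-collision i μ F x t′ t k′<k
          (proj₁ (untagged _ _ k≢k′ tag≡)) (clean d′) (clean d) (sym xs≡))
    where
    clean : ∀ {l t} → dirties i μ F ((x , l) ∷ t) ≡ 0 → dirty (like i μ x) (err i μ F t l k) x k ≡ false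
    clean {l} {t} d = 𝟙-zero _ (∑≡0⇒≡0 {f = λ p → 𝟙 (dirty (like i μ x) (err i μ F t l p) x p)} (m+n≡0⇒m≡0 _ d) (∈-allFin k))
    xs≡ = trans (sym (strings-code _ _ t)) (trans (cong (Vec.map proj₁) tail≡) (strings-code _ _ t′))

  -- Averages of dirty and bad levels over all leaves

  ∑-dirty-class : ∀ (g : Word n → Word s) E p →
    ∑[ x ∈ words n ] 𝟙 (dirty (class g (g x)) E x p) ≤ 2 * K * ∑[ x ∈ words n ] 𝟙 (E x)
  ∑-dirty-class g E p = begin
    ∑[ x ∈ words n ] 𝟙 (dirty (class g (g x)) E x p)
      ≤⟨ ∑-fibres (Vec.≡-dec Bool._≟_) (words n) g (∈-vecs ∈-bits ∘ g) (λ M x → 𝟙 (dirty (class g M) E x p)) ⟩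
    ∑[ M ∈ words s ] (∑[ x ∈ words n ] (𝟙 (class g M x) * 𝟙 (dirty (class g M) E x p)))
      ≤⟨ ∑-mono (words s) (λ M → ∑-dirty (class g M) E p) ⟩
    ∑[ M ∈ words s ] (2 * K * size (class g M ∩ E))
      ≡⟨ ∑-* (2 * K) (words s) _ ⟩
    2 * K * ∑[ M ∈ words s ] size (class g M ∩ E)
      ≡⟨ cong (2 * K *_) (∑-cong (words s) λ M → ∑-cong (words n) λ x → 𝟙-∧ (class g M x) (E x)) ⟩
    2 * K * ∑[ M ∈ words s ] (∑[ x ∈ words n ] (𝟙 (class g M x) * 𝟙 (E x)))
      ≤⟨ *-monoʳ-≤ (2 * K) (∑-fibres⁻ (Vec.≡-dec Bool._≟_) (vecs! bits! s) (words n) g (𝟙 ∘ E)) ⟩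
    2 * K * ∑[ x ∈ words n ] 𝟙 (E x) ∎
    where open ≤-Reasoning

  ∑³ : ∀ m → (Word n → Fin n → Leaf n m → ℕ) → ℕ
  ∑³ m f = ∑[ x ∈ words n ] (∑[ k ∈ allFin n ] (∑[ t ∈ leaves n m ] f x k t))

  ∑³-+ : ∀ m f g → ∑³ m (λ x k t → f x k t + g x k t) ≡ ∑³ m f + ∑³ m g
  ∑³-+ m f g = trans
    (∑-cong (words n) λ x → trans
      (∑-cong (allFin n) λ k → ∑-+ (leaves n m) (f x k) (g x k))
      (∑-+ (allFin n) (λ k → ∑ (leaves n m) (f x k)) (λ k → ∑ (leaves n m) (g x k))))
    (∑-+ (words n) (λ x → ∑[ k ∈ allFin n ] ∑ (leaves n m) (f x k)) (λ x → ∑[ k ∈ allFin n ] ∑ (leaves n m) (g x k)))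

  -- The error set of a level depends on `k`, `t` and `p` but not on `x`. With `x` summed innermost,
  -- the bound for one fixed error set applies.
  ∑³-rotate : ∀ m (f : Word n → Fin n → Leaf n m → Fin n → ℕ) →
    ∑³ m (λ x k t → ∑ (allFin n) (f x k t)) ≡
    ∑[ k ∈ allFin n ] (∑[ t ∈ leaves n m ] (∑[ p ∈ allFin n ] (∑[ x ∈ words n ] f x k t p)))
  ∑³-rotate m f = trans
    (∑-swap (words n) (allFin n) λ x k → ∑[ t ∈ leaves n m ] ∑ (allFin n) (f x k t))
    (∑-cong (allFin n) λ k → trans
      (∑-swap (words n) (leaves n m) λ x t → ∑ (allFin n) (f x k t))
      (∑-cong (leaves n m) λ t → ∑-swap (words n) (allFin n) λ x p → f x k t p))

  ∑-dirties : ∀ {m} i μ (F : Verdict m) → ∑ (leaves n m) (dirties i μ F) ≤ 2 * K * ∑ (leaves n m) (errs i μ F)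
  ∑-dirties {zero}  i μ F = z≤n
  ∑-dirties {suc m} i μ F = begin
    ∑ (leaves n (suc m)) (dirties i μ F)
      ≡⟨ trans (∑-leaves n m (dirties i μ F)) (∑³-+ m _ (λ x k → dirties′ x k)) ⟩
    ∑³ m (λ x k t → ∑ (allFin n) (d x k t)) + ∑³ m dirties′
      ≡⟨ cong (_+ ∑³ m dirties′) (∑³-rotate m d) ⟩
    ∑[ k ∈ allFin n ] (∑[ t ∈ leaves n m ] (∑[ p ∈ allFin n ] (∑[ x ∈ words n ] d x k t p))) + ∑³ m dirties′
      ≤⟨ +-mono-≤ heads tails ⟩
    2 * K * ∑³ m (λ x k t → ∑ (allFin n) (e x k t)) + 2 * K * ∑³ m errs′
      ≡⟨ *-distribˡ-+ (2 * K) (∑³ m (λ x k t → ∑ (allFin n) (e x k t))) _ ⟨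
    2 * K * (∑³ m (λ x k t → ∑ (allFin n) (e x k t)) + ∑³ m errs′)
      ≡⟨ cong (2 * K *_) (sym (trans (∑-leaves n m (errs i μ F)) (∑³-+ m _ (λ x k → errs′ x k)))) ⟩
    2 * K * ∑ (leaves n (suc m)) (errs i μ F) ∎
    where
    open ≤-Reasoning
    d e : Word n → Fin n → Leaf n m → Fin n → ℕ
    d x k t p = 𝟙 (dirty (like i μ x) (err i μ F t k p) x p)
    e x k t p = 𝟙 (err i μ F t k p x)
    dirties′ errs′ : Word n → Fin n → Leaf n m → ℕ
    dirties′ x k = dirties (suc i) (next i μ x k false) (F ▹ x)
    errs′    x k = errs (suc i) (next i μ x k false) (F ▹ x)
    pull : ∀ {A : Set} (xs : List A) {f g : A → ℕ} → (∀ x → f x ≤ 2 * K * g x) → ∑ xs f ≤ 2 * K * ∑ xs g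
    pull xs f≤g = ≤-trans (∑-mono xs f≤g) (≤-reflexive (∑-* (2 * K) xs _))
    heads : ∑[ k ∈ allFin n ] (∑[ t ∈ leaves n m ] (∑[ p ∈ allFin n ] (∑[ x ∈ words n ] d x k t p)))
          ≤ 2 * K * ∑³ m (λ x k t → ∑ (allFin n) (e x k t))
    heads = ≤-trans
      (pull (allFin n) λ k → pull (leaves n m) λ t → pull (allFin n) λ p → ∑-dirty-class (alice i μ) (err i μ F t k p) p)
      (≤-reflexive (cong (2 * K *_) (sym (∑³-rotate m e))))
    tails : ∑³ m dirties′ ≤ 2 * K * ∑³ m errs′
    tails = pull (words n) λ x → pull (allFin n) λ k → ∑-dirties (suc i) (next i μ x k false) (F ▹ x)

  -- Bob's position is uniform and independent of Alice's word, so the average of `heavies` over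
  -- words makes each level bad with frequency at most 1/8, whatever memory it starts from.
  ∑-bads : (∀ (g : Word n → Word s) → 8 * ∑[ x ∈ words n ] heavies (class g (g x)) x ≤ n * 2 ^ n) →
    ∀ {m} i μ → 8 * ∑ (leaves n m) (bads i μ) ≤ m * length (leaves n m)
  ∑-bads few {zero}  i μ = z≤n
  ∑-bads few {suc m} i μ = begin
    8 * ∑ (leaves n (suc m)) (bads i μ)
      ≡⟨ cong (8 *_) (trans (∑-leaves n m (bads i μ)) (∑³-+ m _ (λ x k → bads′ x k))) ⟩
    8 * (∑³ m (λ x k t → 𝟙 (heavy (like i μ x) x k)) + ∑³ m bads′)
      ≡⟨ *-distribˡ-+ 8 (∑³ m (λ x k t → 𝟙 (heavy (like i μ x) x k))) _ ⟩
    8 * ∑³ m (λ x k t → 𝟙 (heavy (like i μ x) x k)) + 8 * ∑³ m bads′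
      ≤⟨ +-mono-≤ heads tails ⟩
    L * (n * 2 ^ n) + 2 ^ n * (n * (m * L))
      ≡⟨ collect L n (2 ^ n) m ⟩
    suc m * (2 ^ n * n * L)
      ≡⟨ cong (suc m *_) (trans (cong (2 ^ n * n *_) (length-leaves n m)) (sym (length-leaves n (suc m)))) ⟩
    suc m * length (leaves n (suc m)) ∎
    where
    open ≤-Reasoning
    L = length (leaves n m)
    collect : ∀ L n N m → L * (n * N) + N * (n * (m * L)) ≡ (1 + m) * (N * n * L)
    collect = solve-∀
    bads′ : Word n → Fin n → Leaf n m → ℕ
    bads′ x k = bads (suc i) (next i μ x k false)
    swap : ∀ L h → 8 * (L * h) ≡ L * (8 * h)
    swap = solve-∀
    heads : 8 * ∑³ m (λ x k t → 𝟙 (heavy (like i μ x) x k)) ≤ L * (n * 2 ^ n)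
    heads = begin
      8 * ∑³ m (λ x k t → 𝟙 (heavy (like i μ x) x k))
        ≡⟨ cong (8 *_) (∑-cong (words n) λ x → trans
             (∑-cong (allFin n) λ k → ∑-const (leaves n m) _)
             (∑-* L (allFin n) (λ k → 𝟙 (heavy (like i μ x) x k)))) ⟩
      8 * ∑[ x ∈ words n ] (L * heavies (like i μ x) x)
        ≡⟨ cong (8 *_) (∑-* L (words n) _) ⟩
      8 * (L * ∑[ x ∈ words n ] heavies (like i μ x) x)
        ≡⟨ swap L _ ⟩
      L * (8 * ∑[ x ∈ words n ] heavies (like i μ x) x)
        ≤⟨ *-monoʳ-≤ L (few (alice i μ)) ⟩
      L * (n * 2 ^ n) ∎
    tails : 8 * ∑³ m bads′ ≤ 2 ^ n * (n * (m * L))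
    tails = begin
      8 * ∑³ m bads′
        ≡⟨ ∑-* 8 (words n) _ ⟨
      ∑[ x ∈ words n ] (8 * ∑[ k ∈ allFin n ] ∑ (leaves n m) (bads′ x k))
        ≤⟨ ∑-≤const (words n) (λ x → ≤-trans (≤-reflexive (sym (∑-* 8 (allFin n) _)))
             (∑-≤const (allFin n) λ k → ∑-bads few {m} (suc i) (next i μ x k false))) ⟩
      length (words n) * (length (allFin n) * (m * L))
        ≡⟨ cong₂ (λ u v → u * (v * (m * L))) (length-words n) (length-allFin n) ⟩
      2 ^ n * (n * (m * L)) ∎

  -- Weights of codes and the memory bound

  weigh : ∀ {m} → Code m → ℕ
  weigh []            = 1
  weigh ((x , c) ∷ t) = maybe′ (λ _ → 1) n c * weigh t

  weigh-code : ∀ {m} i μ (t : Leaf n m) → n ^ bads i μ t * weigh (code i μ t) ≡ n ^ m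
  weigh-code i μ []            = refl
  weigh-code {suc m} i μ ((x , k) ∷ t) with heavy (like i μ x) x k | weigh-code (suc i) (next i μ x k false) t
  ... | true  | ih = trans (regroup n (n ^ bads (suc i) (next i μ x k false) t) _) (cong (n *_) ih)
    where
    regroup : ∀ n p w → n * p * (1 * w) ≡ n * (p * w)
    regroup = solve-∀
  ... | false | ih = trans (regroup n (n ^ bads (suc i) (next i μ x k false) t) _) (cong (n *_) ih)
    where
    regroup : ∀ n p w → p * (n * w) ≡ n * (p * w)
    regroup = solve-∀

  tags : List (Maybe (Fin n))
  tags = nothing ∷ map just (allFin n)

  codes : ∀ m → List (Code m)
  codes = vecs (cartesianProduct (words n) tags)

  ∈-codes : ∀ {m} (c : Code m) → c ∈ codes m
  ∈-codes = ∈-vecs λ { (x , c) → ∈-cartesianProduct⁺ (∈-vecs ∈-bits x) (∈-tags c) }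
    where
    ∈-tags : ∀ c → c ∈ tags
    ∈-tags nothing  = here refl
    ∈-tags (just k) = there (∈-map⁺ just (∈-allFin k))

  -- At each level `nothing` weighs `n`, and so do the `n` tags `just k` together. Recording heavy
  -- positions thus costs only a factor 2 per level over the number of leaves.
  ∑-weigh : ∀ m → ∑ (codes m) weigh ≡ (2 ^ n * (2 * n)) ^ m
  ∑-weigh zero    = refl
  ∑-weigh (suc m) = begin
    ∑ (codes (suc m)) weigh
      ≡⟨ trans (∑-vecs {xs = cartesianProduct (words n) tags} m weigh) (∑-cartesianProductWith _,_ (words n) tags _) ⟩
    ∑[ x ∈ words n ] (∑[ c ∈ tags ] (∑[ t ∈ codes m ] (w₁ c * weigh t)))
      ≡⟨ ∑-const (words n) _ ⟩
    length (words n) * ∑[ c ∈ tags ] (∑[ t ∈ codes m ] (w₁ c * weigh t))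
      ≡⟨ cong₂ _*_ (length-words n) (∑-cong tags λ c → trans (∑-* (w₁ c) (codes m) weigh) (*-comm (w₁ c) _)) ⟩
    2 ^ n * ∑[ c ∈ tags ] (W * w₁ c)
      ≡⟨ cong (2 ^ n *_) (∑-* W tags w₁) ⟩
    2 ^ n * (W * (n + ∑ (map just (allFin n)) w₁))
      ≡⟨ cong (λ z → 2 ^ n * (W * (n + z))) (trans (∑-map just (allFin n) w₁) (trans (∑-const (allFin n) 1) (cong (_* 1) (length-allFin n)))) ⟩
    2 ^ n * (W * (n + n * 1))
      ≡⟨ cong (λ z → 2 ^ n * (z * (n + n * 1))) (∑-weigh m) ⟩
    2 ^ n * ((2 ^ n * (2 * n)) ^ m * (n + n * 1))
      ≡⟨ regroup (2 ^ n) ((2 ^ n * (2 * n)) ^ m) n ⟩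
    (2 ^ n * (2 * n)) ^ suc m ∎
    where
    open ≡-Reasoning
    w₁ : Maybe (Fin n) → ℕ
    w₁ = maybe′ (λ _ → 1) n
    W = ∑ (codes m) weigh
    regroup : ∀ p q n → p * (q * (n + n * 1)) ≡ p * (2 * n) * q
    regroup = solve-∀

  -- Every leaf is dirty, or has more than h bad levels, or is determined by its code and its
  -- final memory; the last two alternatives account for at most half of the leaves.
  memory-bound : .{{_ : NonZero n}} → ∀ h .{{_ : NonZero h}} →
    (∀ (g : Word n → Word s) → 8 * ∑[ x ∈ words n ] heavies (class g (g x)) x ≤ n * 2 ^ n) →
    2 ^ (s + 2 * h + 2) ≤ n ^ h → ∀ μ (F : Verdict (2 * h)) →
    length (leaves n (2 * h)) ≤ 4 * K * ∑ (leaves n (2 * h)) (errs 0 μ F)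
  memory-bound h few s-small μ F = *-cancelˡ-≤ 2 (+-cancelʳ-≤ (N + N) (2 * N) _ (begin
    2 * N + (N + N)                  ≡⟨ four N ⟩
    4 * (N * 1)                      ≡⟨ cong (4 *_) (∑-const (leaves n m) 1) ⟨
    4 * ∑ (leaves n m) (λ _ → 1)       ≤⟨ *-monoʳ-≤ 4 (∑-mono (leaves n m) split) ⟩
    4 * ∑ (leaves n m) (λ t → D t + (B t + C t))
      ≡⟨ cong (4 *_) (trans (∑-+ (leaves n m) D _) (cong (∑ (leaves n m) D +_) (∑-+ (leaves n m) B C))) ⟩
    4 * (∑ (leaves n m) D + (∑ (leaves n m) B + ∑ (leaves n m) C))
      ≡⟨ expand (∑ (leaves n m) D) (∑ (leaves n m) B) _ ⟩
    4 * ∑ (leaves n m) D + (4 * ∑ (leaves n m) B + 4 * ∑ (leaves n m) C)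
      ≤⟨ +-mono-≤ (*-monoʳ-≤ 4 (∑-dirties 0 μ F)) (+-mono-≤ ∑B ∑C) ⟩
    4 * (2 * K * E) + (N + N)        ≡⟨ cong (_+ (N + N)) (regroup K E) ⟩
    2 * (4 * K * E) + (N + N)        ∎))
    where
    open ≤-Reasoning
    m N E : ℕ
    m = 2 * h
    N = length (leaves n m)
    E = ∑ (leaves n m) (errs 0 μ F)
    D B C : Leaf n m → ℕ
    D   = dirties 0 μ F
    B t = 𝟙 ⌊ suc h ≤? bads 0 μ t ⌋
    C t = 𝟙 ⌊ D t ≟ 0 ⌋ * 𝟙 ⌊ bads 0 μ t ≤? h ⌋
    four : ∀ N → 2 * N + (N + N) ≡ 4 * (N * 1)
    four = solve-∀
    expand : ∀ p q r → 4 * (p + (q + r)) ≡ 4 * p + (4 * q + 4 * r)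
    expand = solve-∀
    regroup : ∀ K E → 4 * (2 * K * E) ≡ 2 * (4 * K * E)
    regroup = solve-∀
    split : ∀ t → 1 ≤ D t + (B t + C t)
    split t with D t ≟ 0 | suc h ≤? bads 0 μ t | bads 0 μ t ≤? h
    ... | no D≢0 | _     | _     = ≤-trans (n≢0⇒n>0 D≢0) (m≤m+n (D t) _)
    ... | yes _  | yes _ | _     = ≤-trans (m≤m+n 1 _) (m≤n+m _ (D t))
    ... | yes _  | no _  | yes _ = m≤n+m 1 (D t)
    ... | yes _  | no ≰  | no ≰′ = contradiction (≰⇒> ≰′) ≰
    -- Markov's inequality: on average at most `h / 4` of the `2 * h` levels are bad.
    ∑B : 4 * ∑ (leaves n m) B ≤ N
    ∑B = *-cancelˡ-≤ m {{m*n≢0 2 h}} (begin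
      m * (4 * ∑ (leaves n m) B)          ≡⟨ twice h (∑ (leaves n m) B) ⟩
      8 * (h * ∑ (leaves n m) B)          ≡⟨ cong (8 *_) (∑-* h (leaves n m) B) ⟨
      8 * ∑ (leaves n m) (λ t → h * B t)  ≤⟨ *-monoʳ-≤ 8 (∑-mono (leaves n m) many) ⟩
      8 * ∑ (leaves n m) (bads 0 μ)       ≤⟨ ∑-bads few {m} 0 μ ⟩
      m * N                             ∎)
      where
      twice : ∀ h b → 2 * h * (4 * b) ≡ 8 * (h * b)
      twice = solve-∀
      many : ∀ t → h * B t ≤ bads 0 μ t
      many t with suc h ≤? bads 0 μ t
      ... | yes h<b = ≤-trans (≤-reflexive (*-identityʳ h)) (<⇒≤ h<b)
      ... | no _    = ≤-trans (≤-reflexive (*-zeroʳ h)) z≤n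
    state : Leaf n m → Code m × Word s
    state t = code 0 μ t , final 0 μ (honest t)
    states : List (Code m × Word s)
    states = cartesianProduct (codes m) (words s)
    P : Leaf n m → Bool
    P t = ⌊ D t ≟ 0 ⌋
    -- At least `h` of the `2 * h` levels are untagged, and each contributes a factor `n`.
    few≤weigh : ∀ t → n ^ h * 𝟙 ⌊ bads 0 μ t ≤? h ⌋ ≤ weigh (code 0 μ t)
    few≤weigh t with bads 0 μ t ≤? h
    ... | no _    = ≤-trans (≤-reflexive (*-zeroʳ (n ^ h))) z≤n
    ... | yes b≤h = ≤-trans (≤-reflexive (*-identityʳ (n ^ h))) (*-cancelˡ-≤ (n ^ h) {{m^n≢0 n h}} (begin
      n ^ h * n ^ h                            ≡⟨ ^-distribˡ-+-* n h h ⟨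
      n ^ (h + h)                              ≡⟨ cong (λ e → n ^ (h + e)) (+-identityʳ h) ⟨
      n ^ m                                    ≡⟨ weigh-code 0 μ t ⟨
      n ^ bads 0 μ t * weigh (code 0 μ t)      ≤⟨ *-monoˡ-≤ (weigh (code 0 μ t)) (^-monoʳ-≤ n b≤h) ⟩
      n ^ h * weigh (code 0 μ t)               ∎))
    ∑P : ∑[ t ∈ leaves n m ] (𝟙 (P t) * weigh (code 0 μ t)) ≤ 2 ^ (s + m) * N
    ∑P = begin
      ∑[ t ∈ leaves n m ] (𝟙 (P t) * weigh (code 0 μ t))
        ≤⟨ ∑-injective (Product.≡-dec (Vec.≡-dec (Product.≡-dec (Vec.≡-dec Bool._≟_) (Maybe.≡-dec Fin._≟_))) (Vec.≡-dec Bool._≟_))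
             (leaves! n m) state (λ t → ∈-cartesianProduct⁺ (∈-codes _) (∈-vecs ∈-bits _)) P inj (weigh ∘ proj₁) ⟩
      ∑ states (weigh ∘ proj₁)
        ≡⟨ ∑-cartesianProductWith _,_ (codes m) (words s) (weigh ∘ proj₁) ⟩
      ∑[ c ∈ codes m ] (∑[ M ∈ words s ] weigh c)
        ≡⟨ ∑-cong (codes m) (λ c → trans (∑-const (words s) (weigh c)) (cong (_* weigh c) (length-words s))) ⟩
      ∑[ c ∈ codes m ] (2 ^ s * weigh c)
        ≡⟨ trans (∑-* (2 ^ s) (codes m) weigh) (cong (2 ^ s *_) (∑-weigh m)) ⟩
      2 ^ s * (2 ^ n * (2 * n)) ^ m
        ≡⟨ cong (λ e → 2 ^ s * e ^ m) (swap (2 ^ n) n) ⟩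
      2 ^ s * (2 * (2 ^ n * n)) ^ m
        ≡⟨ cong (2 ^ s *_) (^-distribʳ-* m 2 (2 ^ n * n)) ⟩
      2 ^ s * (2 ^ m * (2 ^ n * n) ^ m)
        ≡⟨ *-assoc (2 ^ s) (2 ^ m) _ ⟨
      2 ^ s * 2 ^ m * (2 ^ n * n) ^ m
        ≡⟨ cong₂ _*_ (sym (^-distribˡ-+-* 2 s m)) (sym (length-leaves n m)) ⟩
      2 ^ (s + m) * N ∎
      where
      swap : ∀ p n → p * (2 * n) ≡ 2 * (p * n)
      swap = solve-∀
      inj : ∀ {t t′} → P t ≡ true → P t′ ≡ true → state t ≡ state t′ → t ≡ t′
      inj {t} {t′} p p′ eq with code≡ , final≡ ← Product.,-injective eq =
        clean-injective 0 μ F t t′ (⌊⌋-true (D t ≟ 0) p) (⌊⌋-true (D t′ ≟ 0) p′) code≡ final≡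
    -- Each leaf counted here uses up weight `n ^ h` out of a total of `2 ^ (s + m) * N`; the
    -- summand 2 in the exponent of the hypothesis leaves a quarter of the leaves.
    ∑C : 4 * ∑ (leaves n m) C ≤ N
    ∑C = *-cancelˡ-≤ (n ^ h) {{m^n≢0 n h}} (begin
      n ^ h * (4 * ∑ (leaves n m) C)                           ≡⟨ swap (n ^ h) _ ⟩
      4 * (n ^ h * ∑ (leaves n m) C)                           ≡⟨ cong (4 *_) (∑-* (n ^ h) (leaves n m) C) ⟨
      4 * ∑[ t ∈ leaves n m ] (n ^ h * C t)                    ≤⟨ *-monoʳ-≤ 4 (∑-mono (leaves n m) weighted) ⟩
      4 * ∑[ t ∈ leaves n m ] (𝟙 (P t) * weigh (code 0 μ t))   ≤⟨ *-monoʳ-≤ 4 ∑P ⟩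
      4 * (2 ^ (s + m) * N)                                  ≡⟨ swap′ (2 ^ (s + m)) N ⟩
      2 ^ (s + m) * 2 ^ 2 * N                                ≡⟨ cong (_* N) (^-distribˡ-+-* 2 (s + m) 2) ⟨
      2 ^ (s + m + 2) * N                                    ≤⟨ *-monoˡ-≤ N s-small ⟩
      n ^ h * N                                              ∎)
      where
      swap : ∀ p q → p * (4 * q) ≡ 4 * (p * q)
      swap = solve-∀
      swap′ : ∀ p q → 4 * (p * q) ≡ p * 4 * q
      swap′ = solve-∀
      exchange : ∀ p q r → p * (q * r) ≡ q * (p * r)
      exchange = solve-∀
      weighted : ∀ t → n ^ h * C t ≤ 𝟙 (P t) * weigh (code 0 μ t)
      weighted t = ≤-trans (≤-reflexive (exchange (n ^ h) (𝟙 (P t)) _)) (*-monoʳ-≤ (𝟙 (P t)) (few≤weigh t))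

-- Averaging over the coins

module Averaging (K : ℕ) {s n c : ℕ}
  (alice : Word c → ℕ → Word s → Word n → Word s) (bob : Word c → ℕ → Word s → List Bool → Word s) where

  module P r = Protocol K (alice r) (bob r)

  -- For a fixed leaf, each pair of a level and a position stands for an error on one input that
  -- does not depend on the coins, so the error probability applies to it.
  ∑-errs : ∀ {D U m} i (μ : Word c → Word s) (F : ∀ r → P.Verdict r m) →
    (∀ t → D * ∑[ r ∈ words c ] 𝟙 (not (P.accepts r i (μ r) (F r) (honest t))) ≤ U) →
    (∀ {t} → Altered t → D * ∑[ r ∈ words c ] 𝟙 (P.accepts r i (μ r) (F r) t) ≤ U) →
    ∀ t → D * ∑[ r ∈ words c ] P.errs r i (μ r) (F r) t ≤ m * (n * U)
  ∑-errs {D} {U} {zero}  i μ F ok bad [] = ≤-trans (≤-reflexive (trans (cong (D *_) (∑-zero (words c))) (*-zeroʳ D))) z≤n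
  ∑-errs {D} {U} {suc m} i μ F ok bad ((x , k) ∷ t) = begin
    D * ∑[ r ∈ words c ] (heads r + tails r)               ≡⟨ cong (D *_) (∑-+ (words c) heads tails) ⟩
    D * (∑ (words c) heads + ∑ (words c) tails)            ≡⟨ *-distribˡ-+ D (∑ (words c) heads) _ ⟩
    D * ∑ (words c) heads + D * ∑ (words c) tails          ≤⟨ +-mono-≤ heads≤ tails≤ ⟩
    suc m * (n * U)                                        ∎
    where
    open ≤-Reasoning
    e : Fin n → Word c → ℕ
    e p r = 𝟙 (P.err r i (μ r) (F r) t k p x)
    heads tails : Word c → ℕ
    heads r = ∑[ p ∈ allFin n ] e p r
    tails r = P.errs r (suc i) (P.next r i (μ r) x k false) (λ M xs → F r M (x ∷ xs)) t
    each : ∀ p → D * ∑ (words c) (e p) ≤ U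
    each p with k Fin.≟ p
    ... | yes _ = bad here
    ... | no _  = ok ((x , k) ∷ t)
    heads≤ : D * ∑ (words c) heads ≤ n * U
    heads≤ = begin
      D * ∑ (words c) heads                           ≡⟨ cong (D *_) (∑-swap (words c) (allFin n) λ r p → e p r) ⟩
      D * ∑[ p ∈ allFin n ] ∑ (words c) (e p)         ≡⟨ ∑-* D (allFin n) _ ⟨
      ∑[ p ∈ allFin n ] (D * ∑ (words c) (e p))       ≤⟨ ∑-≤const (allFin n) each ⟩
      length (allFin n) * U                           ≡⟨ cong (_* U) (length-allFin n) ⟩
      n * U                                           ∎
    tails≤ : D * ∑ (words c) tails ≤ m * (n * U)
    tails≤ = ∑-errs {D} {U} {m} (suc i) (λ r → P.next r i (μ r) x k false) (λ r M xs → F r M (x ∷ xs))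
               (λ t → ok ((x , k) ∷ t)) (λ alt → bad (there alt)) t

  -- `memory-bound` holds for every outcome of the coins. Exchanging the sums over outcomes and
  -- leaves compares it with the error probability of each leaf.
  error-bound : .{{_ : NonZero n}} → ∀ h .{{_ : NonZero h}} →
    (∀ (g : Word n → Word s) → 8 * ∑[ x ∈ words n ] Branching.heavies K (Branching.class K g (g x)) x ≤ n * 2 ^ n) →
    2 ^ (s + 2 * h + 2) ≤ n ^ h →
    ∀ {D C} (μ : Word c → Word s) (F : ∀ r → P.Verdict r (2 * h)) →
    (∀ t → D * ∑[ r ∈ words c ] 𝟙 (not (P.accepts r 0 (μ r) (F r) (honest t))) ≤ C * 2 ^ c) →
    (∀ {t} → Altered t → D * ∑[ r ∈ words c ] 𝟙 (P.accepts r 0 (μ r) (F r) t) ≤ C * 2 ^ c) →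
    D ≤ 4 * K * (2 * h * n * C)
  error-bound h few s-small {D} {C} μ F ok bad = *-cancelʳ-≤ D _ (N * 2 ^ c) {{N*2^c≢0}} (begin
    D * (N * 2 ^ c)                                        ≡⟨ cong (D *_) (trans (*-comm N _) (cong (_* N) (sym (length-words c)))) ⟩
    D * (length (words c) * N)                             ≡⟨ cong (D *_) (∑-const (words c) N) ⟨
    D * ∑[ r ∈ words c ] N                                 ≤⟨ *-monoʳ-≤ D (∑-mono (words c) λ r → P.memory-bound r h few s-small (μ r) (F r)) ⟩
    D * ∑[ r ∈ words c ] (4 * K * ∑ (leaves n m) (e r))    ≡⟨ cong (D *_) (trans (∑-* (4 * K) (words c) _) (cong (4 * K *_) (∑-swap (words c) (leaves n m) e))) ⟩
    D * (4 * K * ∑[ t ∈ leaves n m ] (∑[ r ∈ words c ] e r t))   ≡⟨ swap D (4 * K) _ ⟩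
    4 * K * (D * ∑[ t ∈ leaves n m ] (∑[ r ∈ words c ] e r t))   ≡⟨ cong (4 * K *_) (∑-* D (leaves n m) _) ⟨
    4 * K * ∑[ t ∈ leaves n m ] (D * ∑[ r ∈ words c ] e r t)     ≤⟨ *-monoʳ-≤ (4 * K) (∑-≤const (leaves n m) (∑-errs {D} 0 μ F ok bad)) ⟩
    4 * K * (N * (m * (n * (C * 2 ^ c))))                  ≡⟨ regroup (4 * K) N m n C (2 ^ c) ⟩
    4 * K * (m * n * C) * (N * 2 ^ c)                      ∎)
    where
    open ≤-Reasoning
    m N : ℕ
    m = 2 * h
    N = length (leaves n m)
    e : Word c → Leaf n m → ℕ
    e r = P.errs r 0 (μ r) (F r)
    N*2^c≢0 : NonZero (N * 2 ^ c)
    N*2^c≢0 = m*n≢0 N (2 ^ c) {{subst NonZero (sym (length-leaves n m)) (m^n≢0 (2 ^ n * n) m {{m*n≢0 (2 ^ n) n {{m^n≢0 2 n}}}})}} {{m^n≢0 2 c}}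
    swap : ∀ p q r → p * (q * r) ≡ q * (p * r)
    swap = solve-∀
    regroup : ∀ K N m n C c → K * (N * (m * (n * (C * c)))) ≡ K * (m * n * C) * (N * c)
    regroup = solve-∀

-- Encoding in DYCK(2)

push pop : Bool → Letter
push true  = a
push false = b
pop  true  = ā
pop  false = b̄

-- The deterministic pushdown automaton for the language, with the stack listed from its top.
check : List Bool → List Letter → Bool
check st           (a ∷ w) = check (true ∷ st) w
check st           (b ∷ w) = check (false ∷ st) w
check (true  ∷ st) (ā ∷ w) = check st w
check (false ∷ st) (b̄ ∷ w) = check st w
check []           []      = true
check _            _       = false

check-push : ∀ t st w → check st (push t ∷ w) ≡ check (t ∷ st) w
check-push true  st w = refl
check-push false st w = refl

check-pop : ∀ t st w → check (t ∷ st) (pop t ∷ w) ≡ check st w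
check-pop true  st w = refl
check-pop false st w = refl

check-mismatch : ∀ t st w → check (t ∷ st) (pop (not t) ∷ w) ≡ false
check-mismatch true  st w = refl
check-mismatch false st w = refl

wrap : ∀ t {u v} → Dyck₂ u → Dyck₂ v → Dyck₂ (push t ∷ u ++ pop t ∷ v)
wrap true  = aLāL
wrap false = bLb̄L

check-++ : ∀ {u} → Dyck₂ u → ∀ st w → check st (u ++ w) ≡ check st w
check-++ ε st w = refl
check-++ (aLāL {u} {v} du dv) st w = trans (cong (check (true ∷ st)) (List.++-assoc u (ā ∷ v) w))
  (trans (check-++ du (true ∷ st) (ā ∷ v ++ w)) (check-++ dv st w))
check-++ (bLb̄L {u} {v} du dv) st w = trans (cong (check (false ∷ st)) (List.++-assoc u (b̄ ∷ v) w))
  (trans (check-++ du (false ∷ st) (b̄ ∷ v ++ w)) (check-++ dv st w))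

-- `Dyck₂` relative to a stack of open brackets, the generalisation that induction on the word
-- requires.
Closes : List Bool → List Letter → Set
Closes []       w = Dyck₂ w
Closes (t ∷ st) w = ∃[ u ] ∃[ v ] Dyck₂ u × Closes st v × w ≡ u ++ pop t ∷ v

closes-push : ∀ t st {w} → Closes (t ∷ st) w → Closes st (push t ∷ w)
closes-push t []        (u , v , du , dv , refl) = wrap t du dv
closes-push t (t′ ∷ st) (u , v , du , (u′ , v′ , du′ , cv′ , refl) , refl) =
  push t ∷ u ++ pop t ∷ u′ , v′ , wrap t du du′ , cv′ ,
  cong (push t ∷_) (sym (List.++-assoc u (pop t ∷ u′) (pop t′ ∷ v′)))

check⇒closes : ∀ st w → check st w ≡ true → Closes st w
check⇒closes st           (a ∷ w) eq = closes-push true st (check⇒closes (true ∷ st) w eq)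
check⇒closes st           (b ∷ w) eq = closes-push false st (check⇒closes (false ∷ st) w eq)
check⇒closes (true  ∷ st) (ā ∷ w) eq = [] , w , ε , check⇒closes st w eq , refl
check⇒closes (false ∷ st) (b̄ ∷ w) eq = [] , w , ε , check⇒closes st w eq , refl
check⇒closes []           []      eq = ε
check⇒closes []           (ā ∷ w) ()
check⇒closes []           (b̄ ∷ w) ()
check⇒closes (true  ∷ st) (b̄ ∷ w) ()
check⇒closes (false ∷ st) (ā ∷ w) ()
check⇒closes (true  ∷ st) []      ()
check⇒closes (false ∷ st) []      ()

dyck⇒check : ∀ {w} → Dyck₂ w → check [] w ≡ true
dyck⇒check {w} d = trans (cong (check []) (sym (List.++-identityʳ w))) (check-++ d [] [])

-- Mountains as words of brackets

pushes pops : List Bool → List Letter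
pushes []      = []
pushes (t ∷ x) = pushes x ++ push t ∷ []
pops []      = []
pops (t ∷ x) = pop t ∷ pops x

padding : ℕ → List Letter
padding zero    = []
padding (suc k) = a ∷ ā ∷ padding k

check-pushes : ∀ x st w → check st (pushes x ++ w) ≡ check (x ++ st) w
check-pushes []      st w = refl
check-pushes (t ∷ x) st w = trans (cong (check st) (List.++-assoc (pushes x) (push t ∷ []) w))
  (trans (check-pushes x st (push t ∷ w)) (check-push t (x ++ st) w))

check-pops : ∀ x st w → check (x ++ st) (pops x ++ w) ≡ check st w
check-pops []      st w = refl
check-pops (t ∷ x) st w = trans (check-pop t (x ++ st) (pops x ++ w)) (check-pops x st w)

check-padding : ∀ k st w → check st (padding k ++ w) ≡ check st w
check-padding zero    st w = refl
check-padding (suc k) st w = check-padding k st w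

length-pushes : ∀ x → length (pushes x) ≡ length x
length-pushes []      = refl
length-pushes (t ∷ x) = trans (List.length-++ (pushes x)) (trans (+-comm _ 1) (cong suc (length-pushes x)))

length-pops : ∀ x → length (pops x) ≡ length x
length-pops []      = refl
length-pops (t ∷ x) = cong suc (length-pops x)

length-padding : ∀ k → length (padding k) ≡ 2 * k
length-padding zero    = refl
length-padding (suc k) = trans (cong (λ l → suc (suc l)) (length-padding k)) (sym (*-suc 2 k))

-- The stack is listed from its top, so that the claim of a prefix of x pops just the letters
-- of x pushed last.
probe : ℕ → List Bool → List Letter
probe n w = pops w ++ pushes w ++ padding (n ∸ length w)

body : ∀ {n m} → Input n m → List Letter
body [] = []
body {n} ((x , k , f) ∷ t) = pushes (toList x) ++ probe n (claim x k f) ++ body t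

popAll : ∀ {n m} → Vec (Word n) m → List Letter
popAll []       = []
popAll (x ∷ xs) = popAll xs ++ pops (toList x)

unwind : ∀ {n m} → ℕ → Vec (Word n) m → List Letter
unwind d xs = popAll xs ++ padding d

encode : ∀ {n m} → ℕ → Input n m → List Letter
encode d t = body t ++ unwind d (Vec.map proj₁ t)

claim-prefix : ∀ {n} (x : Word n) k → ∃[ z ] toList x ≡ claim x k false ++ z
claim-prefix (t ∷ x) zero    = toList x , refl
claim-prefix (t ∷ x) (suc k) with z , eq ← claim-prefix x k = z , cong (t ∷_) eq

length-claim : ∀ {n} (x : Word n) k f → length (claim x k f) ≤ n
length-claim (t ∷ x) zero    f = s≤s z≤n
length-claim (t ∷ x) (suc k) f = s≤s (length-claim x k f)

-- The padding makes the length independent of the claim, so the next mountain starts at the same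
-- position for every choice of Bob's.
length-probe : ∀ n w → length w ≤ n → length (probe n w) ≡ 2 * n
length-probe n w w≤n = begin
  length (probe n w)                         ≡⟨ trans (List.length-++ (pops w)) (cong (length (pops w) +_) (List.length-++ (pushes w))) ⟩
  length (pops w) + (length (pushes w) + length (padding (n ∸ length w)))
    ≡⟨ cong₂ _+_ (length-pops w) (cong₂ _+_ (length-pushes w) (length-padding (n ∸ length w))) ⟩
  length w + (length w + 2 * (n ∸ length w)) ≡⟨ twice (length w) (n ∸ length w) ⟩
  2 * (length w + (n ∸ length w))            ≡⟨ cong (2 *_) (m+[n∸m]≡n w≤n) ⟩
  2 * n                                      ∎
  where
  open ≡-Reasoning
  twice : ∀ l d → l + (l + 2 * d) ≡ 2 * (l + d)
  twice = solve-∀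

length-body : ∀ {n m} (t : Input n m) → length (body t) ≡ m * (3 * n)
length-body [] = refl
length-body {n} {suc m} ((x , k , f) ∷ t) = begin
  length (pushes (toList x) ++ probe n (claim x k f) ++ body t)
    ≡⟨ trans (List.length-++ (pushes (toList x))) (cong (length (pushes (toList x)) +_) (List.length-++ (probe n (claim x k f)))) ⟩
  length (pushes (toList x)) + (length (probe n (claim x k f)) + length (body t))
    ≡⟨ cong₂ _+_ (trans (length-pushes (toList x)) (Vec.length-toList x))
                 (cong₂ _+_ (length-probe n (claim x k f) (length-claim x k f)) (length-body t)) ⟩
  n + (2 * n + m * (3 * n))
    ≡⟨ sum n (m * (3 * n)) ⟩
  3 * n + m * (3 * n) ∎
  where
  open ≡-Reasoning
  sum : ∀ n r → n + (2 * n + r) ≡ 3 * n + r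
  sum = solve-∀

length-popAll : ∀ {n m} (xs : Vec (Word n) m) → length (popAll xs) ≡ m * n
length-popAll [] = refl
length-popAll {n} {suc m} (x ∷ xs) = trans (List.length-++ (popAll xs))
  (trans (cong₂ _+_ (length-popAll xs) (trans (length-pops (toList x)) (Vec.length-toList x))) (+-comm (m * n) n))

length-encode : ∀ {n m} d (t : Input n m) → length (encode d t) ≡ 4 * (m * n) + 2 * d
length-encode {n} {m} d t = begin
  length (body t ++ unwind d xs)
    ≡⟨ trans (List.length-++ (body t)) (cong (length (body t) +_) (List.length-++ (popAll xs))) ⟩
  length (body t) + (length (popAll xs) + length (padding d))
    ≡⟨ cong₂ _+_ (length-body t) (cong₂ _+_ (length-popAll xs) (length-padding d)) ⟩
  m * (3 * n) + (m * n + 2 * d)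
    ≡⟨ sum m n d ⟩
  4 * (m * n) + 2 * d ∎
  where
  open ≡-Reasoning
  xs = Vec.map proj₁ t
  sum : ∀ m n d → m * (3 * n) + (m * n + 2 * d) ≡ 4 * (m * n) + 2 * d
  sum = solve-∀

check-probe : ∀ {n} (x : Word n) k st w →
  check (toList x ++ st) (probe n (claim x k false) ++ w) ≡ check (toList x ++ st) w
check-probe {n} x k st w with z , x≡ ← claim-prefix x k = begin
  check (toList x ++ st) (probe n c ++ w)
    ≡⟨ cong₂ check (trans (cong (_++ st) x≡) (List.++-assoc c z st))
         (trans (List.++-assoc (pops c) _ w) (cong (pops c ++_) (List.++-assoc (pushes c) _ w))) ⟩
  check (c ++ (z ++ st)) (pops c ++ pushes c ++ padding (n ∸ length c) ++ w)
    ≡⟨ check-pops c (z ++ st) _ ⟩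
  check (z ++ st) (pushes c ++ padding (n ∸ length c) ++ w)
    ≡⟨ check-pushes c (z ++ st) _ ⟩
  check (c ++ (z ++ st)) (padding (n ∸ length c) ++ w)
    ≡⟨ check-padding (n ∸ length c) _ w ⟩
  check (c ++ (z ++ st)) w
    ≡⟨ cong (λ l → check l w) (trans (sym (List.++-assoc c z st)) (cong (_++ st) (sym x≡))) ⟩
  check (toList x ++ st) w ∎
  where
  open ≡-Reasoning
  c = claim x k false

check-altered-probe : ∀ {n} (x : Word n) k st w →
  check (toList x ++ st) (pops (claim x k true) ++ w) ≡ false
check-altered-probe (t ∷ x) zero    st w = check-mismatch t (toList x ++ st) w
check-altered-probe (t ∷ x) (suc k) st w = trans (check-pop t _ _) (check-altered-probe x k st w)

stack : ∀ {n m} → Vec (Word n) m → List Bool → List Bool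
stack []       st = st
stack (x ∷ xs) st = stack xs (toList x ++ st)

check-level : ∀ {n m} x k f (t : Input n m) st w →
  check st (body ((x , k , f) ∷ t) ++ w) ≡ check (toList x ++ st) (probe n (claim x k f) ++ body t ++ w)
check-level {n} x k f t st w = trans
  (cong (check st) (trans (List.++-assoc (pushes (toList x)) _ w) (cong (pushes (toList x) ++_) (List.++-assoc (probe n (claim x k f)) (body t) w))))
  (check-pushes (toList x) st _)

check-honest : ∀ {n m} (t : Leaf n m) st w →
  check st (body (honest t) ++ w) ≡ check (stack (Vec.map proj₁ (honest t)) st) w
check-honest [] st w = refl
check-honest ((x , k) ∷ t) st w = trans (check-level x k false (honest t) st w)
  (trans (check-probe x k st (body (honest t) ++ w)) (check-honest t (toList x ++ st) w))

check-altered : ∀ {n m} {t : Input n m} → Altered t → ∀ st w → check st (body t ++ w) ≡ false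
check-altered {n} {t = (x , k , true) ∷ t} here st w = trans (check-level x k true t st w)
  (trans (cong (check (toList x ++ st)) (List.++-assoc (pops (claim x k true)) _ _)) (check-altered-probe x k st _))
-- The automaton already rejects at the first alteration.
check-altered {t = (x , k , true) ∷ t}  (there alt) st w = check-altered {t = (x , k , true) ∷ t} here st w
check-altered {t = (x , k , false) ∷ t} (there alt) st w = trans (check-level x k false t st w)
  (trans (check-probe x k st (body t ++ w)) (check-altered alt (toList x ++ st) w))

check-popAll : ∀ {n m} (xs : Vec (Word n) m) st w → check (stack xs st) (popAll xs ++ w) ≡ check st w
check-popAll []       st w = refl
check-popAll (x ∷ xs) st w = trans (cong (check (stack xs (toList x ++ st))) (List.++-assoc (popAll xs) (pops (toList x)) w))
  (trans (check-popAll xs (toList x ++ st) _) (check-pops (toList x) st w))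

encode-honest : ∀ {n m} d (t : Leaf n m) → Dyck₂ (encode d (honest t))
encode-honest d t = check⇒closes [] _ (begin
  check [] (encode d (honest t))                        ≡⟨ check-honest t [] _ ⟩
  check (stack xs []) (popAll xs ++ padding d)          ≡⟨ check-popAll xs [] (padding d) ⟩
  check [] (padding d)                                  ≡⟨ cong (check []) (List.++-identityʳ (padding d)) ⟨
  check [] (padding d ++ [])                            ≡⟨ check-padding d [] [] ⟩
  true                                                  ∎)
  where
  open ≡-Reasoning
  xs = Vec.map proj₁ (honest t)

encode-altered : ∀ {n m} d {t : Input n m} → Altered t → ¬ Dyck₂ (encode d t)
encode-altered d alt dyck = contradiction (trans (sym (dyck⇒check dyck)) (check-altered alt [] _)) λ ()

-- Counting coins

-- `fromℕ` normalises by a gcd and is stuck on a variable; among unnormalised rationals the fraction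
-- is explicit and arithmetic computes.
toℚᵘ-fromℕ : ∀ n → toℚᵘ (fromℕ n) ℚᵘ.≃ ℚᵘ.mkℚᵘ (ℤ.+ n) 0
toℚᵘ-fromℕ n = ℚ.toℚᵘ-fromℚᵘ (ℚᵘ.mkℚᵘ (ℤ.+ n) 0)

fromℕ-+ : ∀ m n → fromℕ (m + n) ≡ fromℕ m ℚ.+ fromℕ n
fromℕ-+ m n = ℚ.toℚᵘ-injective (begin-equality
  toℚᵘ (fromℕ (m + n))                               ≃⟨ toℚᵘ-fromℕ (m + n) ⟩
  ℚᵘ.mkℚᵘ (ℤ.+ (m + n)) 0                            ≡⟨ cong₂ (λ u v → ℚᵘ.mkℚᵘ (u ℤ.+ v) 0) (ℤ.*-identityʳ (ℤ.+ m)) (ℤ.*-identityʳ (ℤ.+ n)) ⟨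
  ℚᵘ.mkℚᵘ (ℤ.+ m) 0 ℚᵘ.+ ℚᵘ.mkℚᵘ (ℤ.+ n) 0           ≃⟨ ℚᵘ.+-cong (toℚᵘ-fromℕ m) (toℚᵘ-fromℕ n) ⟨
  toℚᵘ (fromℕ m) ℚᵘ.+ toℚᵘ (fromℕ n)                 ≃⟨ ℚ.toℚᵘ-homo-+ (fromℕ m) (fromℕ n) ⟨
  toℚᵘ (fromℕ m ℚ.+ fromℕ n)                         ∎)
  where open ℚᵘ.≤-Reasoning

fromℕ-* : ∀ m n → fromℕ (m * n) ≡ fromℕ m ℚ.* fromℕ n
fromℕ-* m n = ℚ.toℚᵘ-injective (begin-equality
  toℚᵘ (fromℕ (m * n))                               ≃⟨ toℚᵘ-fromℕ (m * n) ⟩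
  ℚᵘ.mkℚᵘ (ℤ.+ (m * n)) 0                            ≡⟨ cong (λ u → ℚᵘ.mkℚᵘ u 0) (ℤ.pos-* m n) ⟩
  ℚᵘ.mkℚᵘ (ℤ.+ m) 0 ℚᵘ.* ℚᵘ.mkℚᵘ (ℤ.+ n) 0           ≃⟨ ℚᵘ.*-cong (toℚᵘ-fromℕ m) (toℚᵘ-fromℕ n) ⟨
  toℚᵘ (fromℕ m) ℚᵘ.* toℚᵘ (fromℕ n)                 ≃⟨ ℚ.toℚᵘ-homo-* (fromℕ m) (fromℕ n) ⟨
  toℚᵘ (fromℕ m ℚ.* fromℕ n)                         ∎)
  where open ℚᵘ.≤-Reasoning

fromℕ-mono-≤ : ∀ {m n} → m ≤ n → fromℕ m ℚ.≤ fromℕ n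
fromℕ-mono-≤ {m} {n} m≤n = ℚ.toℚᵘ-cancel-≤ (begin
  toℚᵘ (fromℕ m)      ≃⟨ toℚᵘ-fromℕ m ⟩
  ℚᵘ.mkℚᵘ (ℤ.+ m) 0   ≤⟨ ℚᵘ.*≤* (ℤ.*-monoʳ-≤-nonNeg (ℤ.+ 1) (ℤ.+≤+ m≤n)) ⟩
  ℚᵘ.mkℚᵘ (ℤ.+ n) 0   ≃⟨ toℚᵘ-fromℕ n ⟨
  toℚᵘ (fromℕ n)      ∎)
  where open ℚᵘ.≤-Reasoning

fromℕ-cancel-≤ : ∀ {m n} → fromℕ m ℚ.≤ fromℕ n → m ≤ n
fromℕ-cancel-≤ {m} {n} le = ≮⇒≥ λ n<m → ℤ.<⇒≱ (ℤ.+<+ n<m)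
  (ℤ.*-cancelʳ-≤-pos (ℤ.+ m) (ℤ.+ n) (ℤ.+ 1) (ℚᵘ.drop-*≤* (begin
    ℚᵘ.mkℚᵘ (ℤ.+ m) 0   ≃⟨ toℚᵘ-fromℕ m ⟨
    toℚᵘ (fromℕ m)      ≤⟨ ℚ.toℚᵘ-mono-≤ le ⟩
    toℚᵘ (fromℕ n)      ≃⟨ toℚᵘ-fromℕ n ⟩
    ℚᵘ.mkℚᵘ (ℤ.+ n) 0   ∎)))
  where open ℚᵘ.≤-Reasoning

-- The denominator is at least 1. This exchanges the rational constant of the error bound for a
-- natural number.
≤fromℕ∣↥∣ : ∀ p → p ℚ.≤ fromℕ ℤ.∣ ℚ.↥ p ∣
≤fromℕ∣↥∣ p@(ℚ.mkℚ n d _) = ℚ.toℚᵘ-cancel-≤ (begin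
  ℚᵘ.mkℚᵘ n d                  ≤⟨ ℚᵘ.*≤* (bound n) ⟩
  ℚᵘ.mkℚᵘ (ℤ.+ ℤ.∣ n ∣) 0      ≃⟨ toℚᵘ-fromℕ ℤ.∣ n ∣ ⟨
  toℚᵘ (fromℕ ℤ.∣ n ∣)         ∎)
  where
  open ℚᵘ.≤-Reasoning
  bound : ∀ n → n ℤ.* ℤ.+ 1 ℤ.≤ ℤ.+ ℤ.∣ n ∣ ℤ.* ℤ.+ suc d
  bound (ℤ.+ n)       = subst₂ ℤ._≤_ (ℤ.pos-* n 1) (ℤ.pos-* n (suc d)) (ℤ.+≤+ (*-monoʳ-≤ n (s≤s z≤n)))
  bound (ℤ.-[1+ n ])  = subst (ℤ.-[1+ n ] ℤ.* ℤ.+ 1 ℤ.≤_) (ℤ.pos-* (suc n) (suc d)) (subst (ℤ._≤ ℤ.+ (suc n * suc d)) (sym (ℤ.*-identityʳ ℤ.-[1+ n ])) ℤ.-≤+)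

fromℕ*1/ℕ : ∀ n .{{_ : NonZero n}} → fromℕ n ℚ.* (1/ℕ n) ≡ 1ℚ
fromℕ*1/ℕ (suc n) = ℚ.toℚᵘ-injective (begin-equality
  toℚᵘ (fromℕ (suc n) ℚ.* (1/ℕ suc n))                 ≃⟨ ℚ.toℚᵘ-homo-* (fromℕ (suc n)) (1/ℕ suc n) ⟩
  toℚᵘ (fromℕ (suc n)) ℚᵘ.* toℚᵘ (1/ℕ suc n)           ≃⟨ ℚᵘ.*-cong (toℚᵘ-fromℕ (suc n)) (ℚ.toℚᵘ-fromℚᵘ (ℚᵘ.mkℚᵘ (ℤ.+ 1) n)) ⟩
  ℚᵘ.mkℚᵘ (ℤ.+ suc n) 0 ℚᵘ.* ℚᵘ.mkℚᵘ (ℤ.+ 1) n         ≃⟨ ℚᵘ.*≡* (cong (λ k → ℤ.+ suc k) (cross n)) ⟩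
  toℚᵘ 1ℚ                                              ∎)
  where
  open ℚᵘ.≤-Reasoning
  cross : ∀ n → n * 1 * 1 ≡ n + 0 + 0
  cross = solve-∀

fromℕ-nonNeg : ∀ n → ℚ.NonNegative (fromℕ n)
fromℕ-nonNeg n = ℚ.nonNegative (fromℕ-mono-≤ {0} {n} z≤n)

Pr-count : ∀ {c} (E : Vec Bool c → Bool) → Pr E ℚ.* fromℕ (2 ^ c) ≡ fromℕ (∑[ r ∈ words c ] 𝟙 (E r))
Pr-count {zero} E with E []
... | true  = refl
... | false = refl
Pr-count {suc c} E = begin
  ½ ℚ.* (p ℚ.+ q) ℚ.* fromℕ (2 * 2 ^ c)                  ≡⟨ cong (½ ℚ.* (p ℚ.+ q) ℚ.*_) (fromℕ-* 2 (2 ^ c)) ⟩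
  ½ ℚ.* (p ℚ.+ q) ℚ.* (fromℕ 2 ℚ.* N)                    ≡⟨ regroup p q N ⟩
  p ℚ.* N ℚ.+ q ℚ.* N                                    ≡⟨ cong₂ ℚ._+_ (Pr-count (E ∘ (true ∷_))) (Pr-count (E ∘ (false ∷_))) ⟩
  fromℕ (count true) ℚ.+ fromℕ (count false)             ≡⟨ fromℕ-+ (count true) (count false) ⟨
  fromℕ (count true + count false)                       ≡⟨ cong fromℕ (∑-words c true (𝟙 ∘ E)) ⟨
  fromℕ (∑[ r ∈ words (suc c) ] 𝟙 (E r))                 ∎
  where
  open ≡-Reasoning
  p = Pr (E ∘ (true ∷_))
  q = Pr (E ∘ (false ∷_))
  N = fromℕ (2 ^ c)
  count : Bool → ℕ
  count t = ∑[ r ∈ words c ] 𝟙 (E (t ∷ r))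
  regroup : ∀ p q N → ½ ℚ.* (p ℚ.+ q) ℚ.* (fromℕ 2 ℚ.* N) ≡ p ℚ.* N ℚ.+ q ℚ.* N
  regroup = solve 3 (λ p q N → con ½ :* (p :+ q) :* (con (fromℕ 2) :* N) := p :* N :+ q :* N) refl
    where open +-*-Solver

-- Multiplication by `D * 2 ^ c` clears all denominators, so that the counting argument can stay
-- within the natural numbers.
Pr≤⇒count≤ : ∀ {c} (E : Vec Bool c → Bool) D .{{_ : NonZero D}} {C} → Pr E ℚ.≤ C ℚ.* (1/ℕ D) →
  D * ∑[ r ∈ words c ] 𝟙 (E r) ≤ ℤ.∣ ℚ.↥ C ∣ * 2 ^ c
Pr≤⇒count≤ {c} E D {C} Pr≤ = fromℕ-cancel-≤ (begin
  fromℕ (D * count)                                      ≡⟨ fromℕ-* D count ⟩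
  fromℕ D ℚ.* fromℕ count                                ≡⟨ cong (fromℕ D ℚ.*_) (Pr-count E) ⟨
  fromℕ D ℚ.* (Pr E ℚ.* N)                               ≤⟨ ℚ.*-monoˡ-≤-nonNeg (fromℕ D) {{fromℕ-nonNeg D}} (ℚ.*-monoʳ-≤-nonNeg N {{fromℕ-nonNeg (2 ^ c)}} Pr≤) ⟩
  fromℕ D ℚ.* (C ℚ.* (1/ℕ D) ℚ.* N)                      ≡⟨ regroup (fromℕ D) C (1/ℕ D) N ⟩
  fromℕ D ℚ.* (1/ℕ D) ℚ.* (C ℚ.* N)                      ≡⟨ trans (cong (ℚ._* (C ℚ.* N)) (fromℕ*1/ℕ D)) (ℚ.*-identityˡ _) ⟩
  C ℚ.* N                                                ≤⟨ ℚ.*-monoʳ-≤-nonNeg N {{fromℕ-nonNeg (2 ^ c)}} (≤fromℕ∣↥∣ C) ⟩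
  fromℕ ℤ.∣ ℚ.↥ C ∣ ℚ.* N                                ≡⟨ fromℕ-* ℤ.∣ ℚ.↥ C ∣ (2 ^ c) ⟨
  fromℕ (ℤ.∣ ℚ.↥ C ∣ * 2 ^ c)                            ∎)
  where
  open ℚ.≤-Reasoning
  count = ∑[ r ∈ words c ] 𝟙 (E r)
  N = fromℕ (2 ^ c)
  regroup : ∀ D C i N → D ℚ.* (C ℚ.* i ℚ.* N) ≡ D ℚ.* i ℚ.* (C ℚ.* N)
  regroup = solve 4 (λ D C i N → D :* (C :* i :* N) := D :* i :* (C :* N)) refl
    where open +-*-Solver

≤⇒1/ℕ*≤ : ∀ k .{{_ : NonZero k}} {m n} → m ≤ k * n → (1/ℕ k) ℚ.* fromℕ m ℚ.≤ fromℕ n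
≤⇒1/ℕ*≤ k@(suc _) {m} {n} m≤kn = begin
  (1/ℕ k) ℚ.* fromℕ m                   ≤⟨ ℚ.*-monoˡ-≤-nonNeg (1/ℕ k) {{ℚ.normalize-nonNeg 1 k}} (fromℕ-mono-≤ m≤kn) ⟩
  (1/ℕ k) ℚ.* fromℕ (k * n)             ≡⟨ cong ((1/ℕ k) ℚ.*_) (fromℕ-* k n) ⟩
  (1/ℕ k) ℚ.* (fromℕ k ℚ.* fromℕ n)     ≡⟨ ℚ.*-assoc (1/ℕ k) (fromℕ k) (fromℕ n) ⟨
  (1/ℕ k) ℚ.* fromℕ k ℚ.* fromℕ n       ≡⟨ cong (ℚ._* fromℕ n) (trans (ℚ.*-comm (1/ℕ k) (fromℕ k)) (fromℕ*1/ℕ k)) ⟩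
  1ℚ ℚ.* fromℕ n                        ≡⟨ ℚ.*-identityˡ (fromℕ n) ⟩
  fromℕ n                               ∎
  where open ℚ.≤-Reasoning

Pr-cong : ∀ {c} {E F : Vec Bool c → Bool} → (∀ r → E r ≡ F r) → Pr E ≡ Pr F
Pr-cong {zero}  E≗F = cong (if_then 1ℚ else 0ℚ) (E≗F [])
Pr-cong {suc c} E≗F = cong₂ (λ p q → ½ ℚ.* (p ℚ.+ q)) (Pr-cong λ r → E≗F (true ∷ r)) (Pr-cong λ r → E≗F (false ∷ r))

-- From streaming algorithms to protocols

run : {M : Set} → (ℕ → Letter → M → M) → ℕ → M → List Letter → M
run δ i μ []      = μ
run δ i μ (x ∷ w) = run δ (suc i) (δ i x μ) w

run-++ : ∀ {M : Set} (δ : ℕ → Letter → M → M) i μ v w →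
  run δ i μ (v ++ w) ≡ run δ (i + length v) (run δ i μ v) w
run-++ δ i μ []      w = cong (λ j → run δ j μ w) (sym (+-identityʳ i))
run-++ δ i μ (x ∷ v) w = trans (run-++ δ (suc i) (δ i x μ) v w)
  (cong (λ j → run δ j (run δ (suc i) (δ i x μ) v) w) (sym (+-suc i (length v))))

run-++′ : ∀ {M : Set} (δ : ℕ → Letter → M → M) i {j} μ v w → j ≡ i + length v →
  run δ i μ (v ++ w) ≡ run δ j (run δ i μ v) w
run-++′ δ i μ v w refl = run-++ δ i μ v w

module Simulation {N s} (A : Streaming Letter N s) where

  open Streaming A

  -- Positions become natural numbers, so that a run can be cut between any two letters. Keeping the
  -- memory from `N` on is a default never reached on words of length `N`.
  stepℕ : Vec Bool coins → ℕ → Letter → Memory → Memory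
  stepℕ r i x μ with i <? N
  ... | yes i<N = step r (Fin.fromℕ< i<N) x μ
  ... | no _    = μ

  stepℕ-toℕ : ∀ r j x μ → step r j x μ ≡ stepℕ r (toℕ j) x μ
  stepℕ-toℕ r j x μ with toℕ j <? N
  ... | yes j<N = cong (λ k → step r k x μ) (sym (Fin.fromℕ<-toℕ j j<N))
  ... | no j≮N  = contradiction (Fin.toℕ<n j) j≮N

  read-run : ∀ {m} (δ : Fin m → Letter → Memory → Memory) δ′ i → (∀ j x μ → δ j x μ ≡ δ′ (i + toℕ j) x μ) →
    ∀ μ w → read δ μ w ≡ run δ′ i μ (toList w)
  read-run δ δ′ i δ≗ μ []      = refl
  read-run δ δ′ i δ≗ μ (x ∷ w) = trans
    (cong (λ M → read (δ ∘ suc) M w) (trans (δ≗ zero x μ) (cong (λ j → δ′ j x μ) (+-identityʳ i))))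
    (read-run (δ ∘ suc) δ′ (suc i) (λ j y ν → trans (δ≗ (suc j) y ν) (cong (λ k → δ′ k y ν) (+-suc i (toℕ j)))) _ w)

  verdict : List Letter → Vec Bool coins → Bool
  verdict w r = accept r (run (stepℕ r) 0 (init r) w)

  output≗verdict : ∀ w r → output w r ≡ verdict (toList w) r
  output≗verdict w r = cong (accept r) (read-run (step r) (stepℕ r) 0 (stepℕ-toℕ r) (init r) w)

  two-sided : ∀ {L e} → TwoSidedError L A e → ∀ w → length w ≡ N →
    (L w → Pr (not ∘ verdict w) ℚ.≤ e) × (¬ L w → Pr (verdict w) ℚ.≤ e)
  two-sided {L} {e} err w refl with ok , bad ← err (fromList w)
    rewrite Vec.toList∘fromList w =
      (λ w∈L → subst (ℚ._≤ e) (Pr-cong λ r → cong not (out r)) (ok w∈L)) ,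
      (λ w∉L → subst (ℚ._≤ e) (Pr-cong out) (bad w∉L))
    where
    out : ∀ r → output (fromList w) r ≡ verdict w r
    out r = trans (output≗verdict (fromList w) r) (cong (λ v → verdict v r) (Vec.toList∘fromList w))

  module _ (n : ℕ) where

    -- Mountain `i` begins at position `i * (3 * n)`: `n` letters for Alice's word, then `2 * n` for
    -- Bob's probe.
    alice : Vec Bool coins → ℕ → Memory → Word n → Memory
    alice r i μ x = run (stepℕ r) (i * (3 * n)) μ (pushes (toList x))

    bob : Vec Bool coins → ℕ → Memory → List Bool → Memory
    bob r i μ w = run (stepℕ r) (i * (3 * n) + n) μ (probe n w)

    module A K r = Protocol K (alice r) (bob r)

    judge : ∀ m → ℕ → Vec Bool coins → Memory → Vec (Word n) m → Bool
    judge m d r M xs = accept r (run (stepℕ r) (m * (3 * n)) M (unwind d xs))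

    run-body : ∀ K r {m} i μ (t : Input n m) w →
      run (stepℕ r) (i * (3 * n)) μ (body t ++ w) ≡ run (stepℕ r) ((m + i) * (3 * n)) (A.final K r i μ t) w
    run-body K r i μ [] w = refl
    run-body K r {suc m} i μ ((x , k , f) ∷ t) w = begin
      run δ p μ ((pushes (toList x) ++ probe n c ++ body t) ++ w)
        ≡⟨ cong (run δ p μ) (trans (List.++-assoc (pushes (toList x)) _ w) (cong (pushes (toList x) ++_) (List.++-assoc (probe n c) (body t) w))) ⟩
      run δ p μ (pushes (toList x) ++ probe n c ++ body t ++ w)
        ≡⟨ run-++′ δ p μ (pushes (toList x)) _ (cong (p +_) (sym (trans (length-pushes (toList x)) (Vec.length-toList x)))) ⟩
      run δ (p + n) (alice r i μ x) (probe n c ++ body t ++ w)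
        ≡⟨ run-++′ δ (p + n) (alice r i μ x) (probe n c) _ (trans (sum i n) (cong (p + n +_) (sym (length-probe n c (length-claim x k f))))) ⟩
      run δ (suc i * (3 * n)) (A.next K r i μ x k f) (body t ++ w)
        ≡⟨ run-body K r (suc i) (A.next K r i μ x k f) t w ⟩
      run δ ((m + suc i) * (3 * n)) (A.final K r i μ ((x , k , f) ∷ t)) w
        ≡⟨ cong (λ j → run δ (j * (3 * n)) (A.final K r i μ ((x , k , f) ∷ t)) w) (+-suc m i) ⟩
      run δ ((suc m + i) * (3 * n)) (A.final K r i μ ((x , k , f) ∷ t)) w ∎
      where
      open ≡-Reasoning
      δ = stepℕ r
      p = i * (3 * n)
      c = claim x k f
      sum : ∀ i n → 3 * n + i * (3 * n) ≡ i * (3 * n) + n + 2 * n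
      sum = solve-∀

    accepts-verdict : ∀ K r {m} d (t : Input n m) →
      verdict (encode d t) r ≡ A.accepts K r 0 (init r) (judge m d r) t
    accepts-verdict K r {m} d t = cong (accept r) (trans (run-body K r 0 (init r) t _)
      (cong (λ j → run (stepℕ r) (j * (3 * n)) (A.final K r 0 (init r) t) (unwind d (Vec.map proj₁ t))) (+-identityʳ m)))

  -- The height `64 * q` is `2 * q * j` for `j = 32`, and the final padding of `2 * d` letters
  -- brings the encoding to length `N`.
  error-lower-bound : ∀ {e C} D .{{_ : NonZero D}} → TwoSidedError Dyck₂ A e → e ℚ.≤ C ℚ.* (1/ℕ D) →
    ∀ K → 1 ≤ K → suc K ≡ 4 ^ 32 → ∀ q .{{_ : NonZero q}} h .{{_ : NonZero h}} d →
    N ≡ 4 * (2 * h * (64 * q)) + 2 * d → s + 4 ≤ q → 2 ^ (s + 2 * h + 2) ≤ (64 * q) ^ h →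
    D ≤ 4 * K * (2 * h * (64 * q) * ℤ.∣ ℚ.↥ C ∣)
  error-lower-bound {e} {C} D err e≤ K 1≤K K+1≡ q h d N≡ s+4≤q s-small =
    Averaging.error-bound K (alice n) (bob n) {{m*n≢0 64 q}} h
      (λ g → Branching.∑-heavy K g 1≤K K+1≡ q (double q) s+4≤q) s-small init (judge n m d)
      (λ t → subst (λ k → D * k ≤ C′) (∑-cong (words coins) λ r → cong (𝟙 ∘ not) (accepts-verdict n K r d (honest t)))
        (Pr≤⇒count≤ (not ∘ verdict (encode d (honest t))) D {C} (ℚ.≤-trans (proj₁ (sides (honest t)) (encode-honest d t)) e≤)))
      (λ {t} alt → subst (λ k → D * k ≤ C′) (∑-cong (words coins) λ r → cong 𝟙 (accepts-verdict n K r d t))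
        (Pr≤⇒count≤ (verdict (encode d t)) D {C} (ℚ.≤-trans (proj₂ (sides t) (encode-altered d alt)) e≤)))
    where
    n m C′ : ℕ
    n = 64 * q
    m = 2 * h
    C′ = ℤ.∣ ℚ.↥ C ∣ * 2 ^ coins
    double : ∀ q → 64 * q ≡ 2 * q * 32
    double = solve-∀
    sides : (t : Input n m) → (Dyck₂ (encode d t) → Pr (not ∘ verdict (encode d t)) ℚ.≤ e)
                            × (¬ Dyck₂ (encode d t) → Pr (verdict (encode d t)) ℚ.≤ e)
    sides t = two-sided {Dyck₂} err (encode d t) (trans (length-encode d t) (sym N≡))

-- Parameters

2^⌊log₂⌋≤ : ∀ n .{{_ : NonZero n}} → 2 ^ ⌊log₂ n ⌋ ≤ n
2^⌊log₂⌋≤ n = <-rec (λ n → 1 ≤ n → 2 ^ ⌊log₂ n ⌋ ≤ n) go n (>-nonZero⁻¹ n)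
  where
  open ≤-Reasoning
  2*⌊/2⌋≤ : ∀ n → 2 * ⌊ n /2⌋ ≤ n
  2*⌊/2⌋≤ n = ≤-trans (+-monoʳ-≤ ⌊ n /2⌋ (≤-trans (≤-reflexive (+-identityʳ ⌊ n /2⌋)) (⌊n/2⌋≤⌈n/2⌉ n)))
                      (≤-reflexive (⌊n/2⌋+⌈n/2⌉≡n n))
  2^≤2*2^pred : ∀ k → 2 ^ k ≤ 2 * 2 ^ (k ∸ 1)
  2^≤2*2^pred zero    = s≤s z≤n
  2^≤2*2^pred (suc k) = ≤-refl
  go : ∀ n → (∀ {m} → m < n → 1 ≤ m → 2 ^ ⌊log₂ m ⌋ ≤ m) → 1 ≤ n → 2 ^ ⌊log₂ n ⌋ ≤ n
  go 1 rec _ = ≤-reflexive (cong (2 ^_) (⌊log₂[2^n]⌋≡n 0))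
  go n@(suc (suc k)) rec _ = begin
    2 ^ ⌊log₂ n ⌋                ≤⟨ 2^≤2*2^pred ⌊log₂ n ⌋ ⟩
    2 * 2 ^ (⌊log₂ n ⌋ ∸ 1)      ≡⟨ cong (λ l → 2 * 2 ^ l) (⌊log₂⌊n/2⌋⌋≡⌊log₂n⌋∸1 n) ⟨
    2 * 2 ^ ⌊log₂ ⌊ n /2⌋ ⌋      ≤⟨ *-monoʳ-≤ 2 (rec (⌊n/2⌋<n (suc k)) (s≤s z≤n)) ⟩
    2 * ⌊ n /2⌋                  ≤⟨ 2*⌊/2⌋≤ n ⟩
    n                            ∎

≤⌊√⌋ : ∀ {k n} → k * k ≤ n → k ≤ ⌊√ n ⌋
≤⌊√⌋ {k} {n} k²≤n = ≮⇒≥ λ r<k → <⇒≱ (<-≤-trans (proj₂ (⌊√⌋-spec n)) (*-mono-≤ r<k r<k)) k²≤n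

m<[1+m/n]*n : ∀ m n .{{_ : NonZero n}} → m < suc (m / n) * n
m<[1+m/n]*n m n = ≤-<-trans (≤-reflexive (m≡m%n+[m/n]*n m n)) (+-monoˡ-< (m / n * n) (m%n<n m n))

m*n≤o⇒m≤o/n : ∀ m n o .{{_ : NonZero n}} → m * n ≤ o → m ≤ o / n
m*n≤o⇒m≤o/n m n o le = ≤-trans (≤-reflexive (sym (m*n/n≡m m n))) (/-monoˡ-≤ n le)

8*≤2^ : ∀ {n} → 6 ≤ n → 8 * n ≤ 2 ^ n
8*≤2^ {n} 6≤n = subst (λ k → 8 * k ≤ 2 ^ k) (m+[n∸m]≡n 6≤n) (go (n ∸ 6))
  where
  open ≤-Reasoning
  go : ∀ k → 8 * (6 + k) ≤ 2 ^ (6 + k)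
  go zero    = m≤m+n 48 16
  go (suc k) = begin
    8 * (6 + suc k)                ≡⟨ cong (8 *_) (+-suc 6 k) ⟩
    8 * suc (6 + k)                ≡⟨ *-suc 8 (6 + k) ⟩
    8 + 8 * (6 + k)                ≤⟨ +-monoˡ-≤ (8 * (6 + k)) (m≤m*n 8 (6 + k)) ⟩
    8 * (6 + k) + 8 * (6 + k)      ≡⟨ cong (8 * (6 + k) +_) (+-identityʳ _) ⟨
    2 * (8 * (6 + k))              ≤⟨ *-monoʳ-≤ 2 (go k) ⟩
    2 * 2 ^ (6 + k)                ≡⟨ cong (2 ^_) (+-suc 6 k) ⟨
    2 ^ (6 + suc k)                ∎

Parameters : (N s q h d : ℕ) → Set
Parameters N s q h d = NonZero q × NonZero h × N ≡ 4 * (2 * h * (64 * q)) + 2 * d ×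
  s + 4 ≤ q × 2 ^ (s + 2 * h + 2) ≤ (64 * q) ^ h

-- Mountains of height 64 q ≈ √(N log N), of which there are 2 h ≈ √(N / log N) / 4.
parameters : ∀ N s .{{_ : NonZero N}} → 2 ∣ N → 48 ≤ ⌊log₂ N ⌋ → 256 * s < ⌊√ N * ⌊log₂ N ⌋ ⌋ →
  ∃[ q ] ∃[ h ] ∃[ d ] Parameters N s q h d
parameters N s (divides e N≡) 48≤L 256s<Q =
  q , h , e ∸ 2 * (2 * h * (64 * q)) , >-nonZero (≤-trans (m≤n+m 1 3) (≤-trans (m≤n+m 4 s) s+4≤q)) , h≢0 , length≡ , s+4≤q , memory
  where
  open ≤-Reasoning
  L Q u t : ℕ
  L = ⌊log₂ N ⌋
  Q = ⌊√ N * L ⌋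
  u = L / 8
  t = suc u
  instance
    L≢0 : NonZero L
    L≢0 = >-nonZero (≤-trans (s≤s z≤n) 48≤L)
    8L≢0 : NonZero (8 * L)
    8L≢0 = m*n≢0 8 L
  q h : ℕ
  q = Q / 64
  h = Q / (8 * L)
  -- The bound 48 is `8 * 6`, where 6 is the point from which `8 * t ≤ 2 ^ t` holds.
  6≤u : 6 ≤ u
  6≤u = /-monoˡ-≤ 8 48≤L
  6≤t : 6 ≤ t
  6≤t = ≤-trans 6≤u (n≤1+n u)
  L≤8t : L ≤ 8 * t
  L≤8t = ≤-trans (<⇒≤ (m<[1+m/n]*n L 8)) (≤-reflexive (*-comm t 8))
  2^[t+3]≤Q : 2 ^ (t + 3) ≤ Q
  2^[t+3]≤Q = ≤⌊√⌋ (begin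
    2 ^ (t + 3) * 2 ^ (t + 3)    ≡⟨ ^-distribˡ-+-* 2 (t + 3) (t + 3) ⟨
    2 ^ (t + 3 + (t + 3))        ≤⟨ ^-monoʳ-≤ 2 exponent ⟩
    2 ^ L                        ≤⟨ 2^⌊log₂⌋≤ N ⟩
    N                            ≤⟨ m≤m*n N L ⟩
    N * L                        ∎)
    where
    expand : ∀ u → 1 + u + 3 + (1 + u + 3) ≡ 2 * u + 8
    expand = solve-∀
    collect : ∀ u → 2 * u + 6 * u ≡ u * 8
    collect = solve-∀
    exponent : t + 3 + (t + 3) ≤ L
    exponent = begin
      t + 3 + (t + 3)  ≡⟨ expand u ⟩
      2 * u + 8        ≤⟨ +-monoʳ-≤ (2 * u) (≤-trans (m≤n+m 8 28) (*-monoʳ-≤ 6 6≤u)) ⟩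
      2 * u + 6 * u    ≡⟨ collect u ⟩
      u * 8            ≤⟨ m/n*n≤m L 8 ⟩
      L                ∎
  8*2^t≡ : 8 * 2 ^ t ≡ 2 ^ (t + 3)
  8*2^t≡ = trans (*-comm 8 (2 ^ t)) (sym (^-distribˡ-+-* 2 t 3))
  8L≤Q : 8 * L ≤ Q
  8L≤Q = begin
    8 * L          ≤⟨ *-monoʳ-≤ 8 (≤-trans L≤8t (8*≤2^ 6≤t)) ⟩
    8 * 2 ^ t      ≡⟨ 8*2^t≡ ⟩
    2 ^ (t + 3)    ≤⟨ 2^[t+3]≤Q ⟩
    Q              ∎
  64≤2^t : 64 ≤ 2 ^ t
  64≤2^t = ^-monoʳ-≤ 2 6≤t
  512≤Q : 512 ≤ Q
  512≤Q = ≤-trans (*-monoʳ-≤ 8 64≤2^t) (≤-trans (≤-reflexive 8*2^t≡) 2^[t+3]≤Q)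
  s+4≤q : s + 4 ≤ q
  s+4≤q = m*n≤o⇒m≤o/n (s + 4) 64 Q (*-cancelˡ-≤ 4 (begin
    4 * ((s + 4) * 64)     ≡⟨ expand s ⟩
    256 * s + 2 * 512      ≤⟨ +-mono-≤ (<⇒≤ 256s<Q) (*-monoʳ-≤ 2 512≤Q) ⟩
    Q + 2 * Q              ≤⟨ m≤n+m (3 * Q) Q ⟩
    4 * Q                  ∎))
    where
    expand : ∀ s → 4 * ((s + 4) * 64) ≡ 256 * s + 1024
    expand = solve-∀
  1≤h : 1 ≤ h
  1≤h = m*n≤o⇒m≤o/n 1 (8 * L) Q (≤-trans (≤-reflexive (*-identityˡ (8 * L))) 8L≤Q)
  h≢0 : NonZero h
  h≢0 = >-nonZero 1≤h
  -- Up to rounding `t` is `L / 8` and `h` is `Q / (8 * L)`. Rounding costs at most a factor 2, so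
  -- `Q ≤ 128 * (t * h)`, and twice this bound covers `256 * s + 512`.
  s+2≤th : s + 2 ≤ t * h
  s+2≤th = *-cancelˡ-≤ 256 (begin
    256 * (s + 2)                ≡⟨ *-distribˡ-+ 256 s 2 ⟩
    256 * s + 512                ≤⟨ +-mono-≤ (<⇒≤ 256s<Q) 512≤Q ⟩
    Q + Q                        ≤⟨ +-mono-≤ Q≤ Q≤ ⟩
    (h + h) * (8 * (8 * t)) + (h + h) * (8 * (8 * t))    ≡⟨ collect h t ⟩
    256 * (t * h)                ∎)
    where
    collect : ∀ h t → (h + h) * (8 * (8 * t)) + (h + h) * (8 * (8 * t)) ≡ 256 * (t * h)
    collect = solve-∀
    Q≤ : Q ≤ (h + h) * (8 * (8 * t))
    Q≤ = begin
      Q                          ≤⟨ <⇒≤ (m<[1+m/n]*n Q (8 * L)) ⟩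
      suc h * (8 * L)            ≤⟨ *-mono-≤ (+-monoˡ-≤ h 1≤h) (*-monoʳ-≤ 8 L≤8t) ⟩
      (h + h) * (8 * (8 * t))    ∎
  2^[t+2]≤64q : 2 ^ (t + 2) ≤ 64 * q
  2^[t+2]≤64q = +-cancelʳ-≤ (2 ^ (t + 2)) _ _ (begin
    2 ^ (t + 2) + 2 ^ (t + 2)    ≡⟨ cong (2 ^ (t + 2) +_) (+-identityʳ _) ⟨
    2 ^ suc (t + 2)              ≡⟨ cong (2 ^_) (+-suc t 2) ⟨
    2 ^ (t + 3)                  ≤⟨ 2^[t+3]≤Q ⟩
    Q                            ≤⟨ <⇒≤ (m<[1+m/n]*n Q 64) ⟩
    64 + q * 64                  ≡⟨ trans (+-comm 64 (q * 64)) (cong (_+ 64) (*-comm q 64)) ⟩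
    64 * q + 64                  ≤⟨ +-monoʳ-≤ (64 * q) (≤-trans 64≤2^t (^-monoʳ-≤ 2 (m≤m+n t 2))) ⟩
    64 * q + 2 ^ (t + 2)         ∎)
  memory : 2 ^ (s + 2 * h + 2) ≤ (64 * q) ^ h
  memory = begin
    2 ^ (s + 2 * h + 2)      ≡⟨ cong (2 ^_) (rearrange s h) ⟩
    2 ^ (s + 2 + 2 * h)      ≤⟨ ^-monoʳ-≤ 2 (+-monoˡ-≤ (2 * h) s+2≤th) ⟩
    2 ^ (t * h + 2 * h)      ≡⟨ cong (2 ^_) (*-distribʳ-+ h t 2) ⟨
    2 ^ ((t + 2) * h)        ≡⟨ ^-*-assoc 2 (t + 2) h ⟨
    (2 ^ (t + 2)) ^ h        ≤⟨ ^-monoˡ-≤ h 2^[t+2]≤64q ⟩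
    (64 * q) ^ h             ∎
    where
    rearrange : ∀ s h → s + 2 * h + 2 ≡ s + 2 + 2 * h
    rearrange = solve-∀
  -- Multiplied by `2 * L`, the left side is a product of two factors that are each at most `Q`, and
  -- `Q * Q ≤ N * L`.
  fits : 2 * (2 * h * (64 * q)) ≤ e
  fits = *-cancelʳ-≤ _ e 2 (*-cancelʳ-≤ _ _ L (begin
    2 * (2 * h * (64 * q)) * 2 * L    ≡⟨ regroup h q L ⟩
    h * (8 * L) * (q * 64)            ≤⟨ *-mono-≤ (m/n*n≤m Q (8 * L)) (m/n*n≤m Q 64) ⟩
    Q * Q                             ≤⟨ proj₁ (⌊√⌋-spec (N * L)) ⟩
    N * L                             ≡⟨ cong (_* L) N≡ ⟩
    e * 2 * L                         ∎))
    where
    regroup : ∀ h q L → 2 * (2 * h * (64 * q)) * 2 * L ≡ h * (8 * L) * (q * 64)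
    regroup = solve-∀
  length≡ : N ≡ 4 * (2 * h * (64 * q)) + 2 * (e ∸ 2 * (2 * h * (64 * q)))
  length≡ = begin-equality
    N                                                  ≡⟨ trans N≡ (*-comm e 2) ⟩
    2 * e                                              ≡⟨ cong (2 *_) (m+[n∸m]≡n fits) ⟨
    2 * (2 * k + (e ∸ 2 * k))                          ≡⟨ expand k (e ∸ 2 * k) ⟩
    4 * k + 2 * (e ∸ 2 * k)                            ∎
    where
    k = 2 * h * (64 * q)
    expand : ∀ k d → 2 * (2 * k + d) ≡ 4 * k + 2 * d
    expand = solve-∀

-- Abstract, since unfolding 2 ^ 64 would exhaust memory.
abstract
  threshold : ℕ
  threshold = pred (4 ^ 32)

  1≤threshold : 1 ≤ threshold
  1≤threshold = s≤s z≤n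

  threshold+1≡4^32 : suc threshold ≡ 4 ^ 32
  threshold+1≡4^32 = refl

-- With too little space, the error bound would give `n * L ≤ 4 * K * (m * height * C)`. The
-- encoding has length `n`, so `4 * m * height ≤ n`, and `L ≤ K * C` fails for large `n`.
corollary1 : (s : ℕ → ℕ) (A : ∀ n → Streaming Letter n (s n)) (err : ℕ → ℚ) →
    (∀ n → TwoSidedError Dyck₂ (A n) (err n)) →
    err ∈O (λ n → 1/ℕ (n * ⌊log₂ n ⌋)) →
    (fromℕ ∘ s) ∈Ω (λ n → fromℕ ⌊√ n * ⌊log₂ n ⌋ ⌋) along (2 ∣_)
corollary1 s A err correct (C , N₀ , _ , err≤) =
  1/ℕ 256 , N₀ + 2 ^ E , ℚ.positive⁻¹ (1/ℕ 256) , bound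
  where
  E : ℕ
  -- From `2 ^ E` on, the logarithm is at least 48, as the parameters require, and exceeds
  -- `threshold * C′`, which is what contradicts the error bound.
  E = threshold * ℤ.∣ ℚ.↥ C ∣ + 48
  bound : ∀ n → N₀ + 2 ^ E ≤ n → 2 ∣ n → (1/ℕ 256) ℚ.* fromℕ ⌊√ n * ⌊log₂ n ⌋ ⌋ ℚ.≤ fromℕ (s n)
  bound n N≤n 2∣n = ≤⇒1/ℕ*≤ 256 {n = s n} (≮⇒≥ λ 256s<Q → too-accurate (parameters n (s n) {{n≢0}} 2∣n 48≤L 256s<Q))
    where
    open ≤-Reasoning
    L C′ : ℕ
    L  = ⌊log₂ n ⌋
    C′ = ℤ.∣ ℚ.↥ C ∣
    2^E≤n : 2 ^ E ≤ n
    2^E≤n = m+n≤o⇒n≤o N₀ N≤n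
    n≢0 : NonZero n
    n≢0 = >-nonZero (≤-trans (m^n>0 2 E) 2^E≤n)
    E≤L : E ≤ L
    E≤L = ≤-trans (≤-reflexive (sym (⌊log₂[2^n]⌋≡n E))) (⌊log₂⌋-mono-≤ 2^E≤n)
    48≤L : 48 ≤ L
    48≤L = ≤-trans (m≤n+m 48 (threshold * C′)) E≤L
    L≢0 : NonZero L
    L≢0 = >-nonZero (≤-trans (s≤s z≤n) 48≤L)
    <L : threshold * C′ < L
    <L = <-≤-trans (m<m+n (threshold * C′) (s≤s z≤n)) E≤L
    regroup : ∀ K m C → 4 * K * (m * C) ≡ 4 * m * (K * C)
    regroup = solve-∀
    too-accurate : ¬ (∃[ q ] ∃[ h ] ∃[ d ] Parameters n (s n) q h d)
    too-accurate (q , h , d , q≢0 , h≢0 , n≡ , s+4≤q , memory) =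
      <⇒≱ <L (*-cancelˡ-≤ n {{n≢0}} (begin
        n * L
          ≤⟨ Simulation.error-lower-bound (A n) {C = C} (n * L) {{m*n≢0 n L {{n≢0}} {{L≢0}}}} (correct n) (err≤ n (m+n≤o⇒m≤o N₀ N≤n))
               threshold 1≤threshold threshold+1≡4^32 q {{q≢0}} h {{h≢0}} d n≡ s+4≤q memory ⟩
        4 * threshold * (2 * h * (64 * q) * C′)          ≡⟨ regroup threshold (2 * h * (64 * q)) C′ ⟩
        4 * (2 * h * (64 * q)) * (threshold * C′)        ≤⟨ *-monoˡ-≤ (threshold * C′) (m≤m+n (4 * (2 * h * (64 * q))) (2 * d)) ⟩
        (4 * (2 * h * (64 * q)) + 2 * d) * (threshold * C′)  ≡⟨ cong (_* (threshold * C′)) n≡ ⟨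
        n * (threshold * C′)                             ∎))
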